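{- For a graphing $\mathbf{G}=(J,\mathcal{B},E,\lambda)$ let its total rank be $$\overline{\rho}(\mathbf{G})=1-\mathsf{E}\Big(\frac{1}{|V(\mathbf{G}_{\mathbf{u}})|}\Big),$$ where $\mathbf{u}$ is a random point of $J$ with distribution $\lambda$ and $V(\mathbf{G}_u)$ is the node set of the connected component of $\mathbf{G}$ containing $u$ (with $1/\infty=0$); for a finite graph $G$ define $\overline{\rho}(G)$ analogously, with $\mathbf{u}$ a uniform random node of $G$. (a) The graphing parameter $\overline{\rho}$ is locally estimable. (b) If $G_1,G_2,\ldots$ is a sequence of finite graphs with all degrees bounded by $D\ge 0$ locally converging to a graphing $\mathbf{G}$, then $\overline{\rho}(G_n)\to\overline{\rho}(\mathbf{G})$ as $n\to\infty$.
   Context: A graphing is a quadruple $\mathbf{G}=(J,\mathcal{B},E,\lambda)$, where $(J,\mathcal{B})$ is a standard Borel space, $\lambda$ is a probability measure on $\mathcal{B}$, and $E$ is a Borel set of unordered pairs of distinct points of $J$ (identified with a symmetric Borel subset of $J\times J$ disjoint from the diagonal), such that all degrees of the graph $(J,E)$ are bounded by a finite integer and $$\int_A \deg_B(x)\,d\lambda(x)=\int_B \deg_A(x)\,d\lambda(x)\qquad\text{for all }A,B\in\mathcal{B},$$ where $\deg_B(x)$ is the number of edges from $x$ to points of $B$. A finite graph with the uniform distribution on its nodes is a special case. For a node $x$ and an integer $r\ge1$, $B_r(x)$ denotes the $r$-ball centered at $x$: the subgraph induced by the nodes at graph distance at most $r$ from $x$, regarded as a finite rooted graph with root $x$, up to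 rooted isomorphism. A graphing parameter $f$ (a real-valued function of graphings) is locally estimable if for every error bound $\varepsilon>0$ and degree bound $D\ge0$ there are integers $k,r\ge1$ depending only on $\varepsilon$ and $D$ such that for any graphing $\mathbf{G}=(J,\mathcal{B},E,\lambda)$ with maximum degree (at most) $D$, selecting $k$ independent random nodes $x_1,\dots,x_k$ from $\lambda$ and considering their neighborhoods $B_r(x_1),\dots,B_r(x_k)$, one can compute from these neighborhoods (i.e. as a function, depending only on $\varepsilon$ and $D$, of the $k$-tuple of isomorphism types of rooted graphs $B_r(x_1),\dots,B_r(x_k)$) an estimate $R$ of $f(\mathbf{G})$ such that $\Pr\big(|R-f(\mathbf{G})|\ge\varepsilon\big)\le\varepsilon$. This applies in particular to finite graphs. A sequence of finite graphs $G_n$ with all degrees bounded by $D$ is said to locally converge to a graphing $\mathbf{G}$ if for every $r\ge1$, the distribution of the $r$-ball (up to rooted isomorphism) centered at a uniform random node of $G_n$ converges, as $n\to\infty$, to the distribution of the $r$-ball centered at a random point of $\mathbf{G}$ chosen from $\lambda$. -}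

module Defs where

open import Level using (0ℓ; _⊔_) renaming (suc to lsuc)
open import Algebra.Bundles using (CommutativeRing)
import Algebra.Properties.CommutativeMonoid.Sum as CommutativeMonoidSum
import Algebra.Properties.Monoid.Mult as MonoidMult
open import Axiom.ExcludedMiddle using (ExcludedMiddle)
open import Data.Bool using (Bool; false; T)
open import Data.Fin using (Fin; toℕ)
open import Data.Maybe using (Maybe; just; nothing)
open import Data.Nat as ℕ using (ℕ; suc; NonZero)
open import Data.Product using (Σ; ∃; Σ-syntax; ∃-syntax; _×_; _,_)
open import Data.Sum using (inj₁; inj₂)
open import Function using (_⇔_; _↔_; Inverse; Injective)
open import Relation.Binary using (Rel; IsTotalOrder; Symmetric; Irreflexive)
open import Relation.Binary.Construct.Closure.ReflexiveTransitive using (Star)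
open import Relation.Binary.PropositionalEquality using (_≡_)
open import Relation.Nullary using (¬_; yes; no)
open import Relation.Unary using (Pred; _∈_; _≐_; _∩_; ∁; U; ⋃; ⋂; _⊢_; _⟨×⟩_)

-- Subsets of a type X are predicates in Pred X 0ℓ, compared by _≐_; families of
-- subsets are predicates on these.

-- The reals are axiomatised as a complete ordered field, which determines them
-- up to unique isomorphism.  Completeness is required for predicates in Set₁
-- because lower sums of integrals quantify over subsets.
record CompleteOrderedField : Set₂ where
  infix  4 _≤_
  infix  8 _⁻¹

  field
    commutativeRing : CommutativeRing 0ℓ 0ℓ

  open CommutativeRing commutativeRing public

  field
    _≤_          : Rel Carrier 0ℓ
    _⁻¹          : Carrier → Carrier
    isTotalOrder : IsTotalOrder _≈_ _≤_
    0≉1          : ¬ 0# ≈ 1#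
    ⁻¹-cong      : ∀ {x y} → x ≈ y → x ⁻¹ ≈ y ⁻¹
    ⁻¹-inverseʳ  : ∀ {x} → ¬ x ≈ 0# → x * x ⁻¹ ≈ 1#
    +-monoʳ-≤    : ∀ x {y z} → y ≤ z → x + y ≤ x + z
    *-nonneg     : ∀ {x y} → 0# ≤ x → 0# ≤ y → 0# ≤ x * y

  IsUpperBound : ∀ {ℓ} → Pred Carrier ℓ → Carrier → Set ℓ
  IsUpperBound P b = ∀ {x} → x ∈ P → x ≤ b

  IsSupremum : ∀ {ℓ} → Pred Carrier ℓ → Carrier → Set ℓ
  IsSupremum P s = IsUpperBound P s × (∀ {b} → IsUpperBound P b → s ≤ b)

  field
    complete : (P : Pred Carrier (lsuc 0ℓ)) → ∃ P → ∃ (IsUpperBound P) →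
               ∃ (IsSupremum P)

  open IsTotalOrder isTotalOrder public using (total)

  infix 4 _<_
  _<_ : Rel Carrier 0ℓ
  x < y = x ≤ y × ¬ x ≈ y

  ∣_∣ : Carrier → Carrier
  ∣ x ∣ with total 0# x
  ... | inj₁ _ = x
  ... | inj₂ _ = - x

  fromℕ : ℕ → Carrier
  fromℕ n = MonoidMult._×_ +-monoid n 1#

  ∑ ∏ : ∀ {n} → (Fin n → Carrier) → Carrier
  ∑ = CommutativeMonoidSum.sum +-commutativeMonoid
  ∏ = CommutativeMonoidSum.sum *-commutativeMonoid

  Tendsto : (ℕ → Carrier) → Carrier → Set
  Tendsto s l = ∀ ε → 0# < ε → ∃[ N ] ∀ n → N ℕ.≤ n → ∣ s n - l ∣ < ε

Enumerates : ∀ {X : Set} {n} → (Fin n → X) → Pred X 0ℓ → Set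
Enumerates f P = Injective _≡_ _≡_ f × (∀ x → P x ⇔ (∃[ i ] f i ≡ x))

HasSize : ∀ {X : Set} → Pred X 0ℓ → ℕ → Set
HasSize {X} P n = Σ[ f ∈ (Fin n → X) ] Enumerates f P

module _ {V : Set} (Adj : Rel V 0ℓ) where

  Neighbours : V → Pred V 0ℓ
  Neighbours x y = Adj x y

  DegreesBoundedBy : ℕ → Set
  DegreesBoundedBy D = ∀ x → ∃[ n ] n ℕ.≤ D × HasSize (Neighbours x) n

  Component : V → Pred V 0ℓ
  Component u v = Star Adj u v

  data Distance≤ : ℕ → V → V → Set where
    here : ∀ {r x} → Distance≤ r x x
    step : ∀ {r x y z} → Adj x y → Distance≤ r y z → Distance≤ (suc r) x z

record FiniteGraph : Set where
  field
    size       : ℕ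
    nonempty   : NonZero size
    adj        : Fin size → Fin size → Bool
    adj-sym    : ∀ i j → adj i j ≡ adj j i
    adj-irrefl : ∀ i → adj i i ≡ false

  Adj : Rel (Fin size) 0ℓ
  Adj i j = T (adj i j)

record RootedGraph : Set where
  field
    graph : FiniteGraph
  open FiniteGraph graph public
  field
    root : Fin size

record _≅_ (S S′ : RootedGraph) : Set where
  private
    module S  = RootedGraph S
    module S′ = RootedGraph S′
  field
    bijection : Fin S.size ↔ Fin S′.size
  open Inverse bijection using (to)
  field
    preserves-adj  : ∀ i j → S.adj i j ≡ S′.adj (to i) (to j)
    preserves-root : to S.root ≡ S′.root

-- BallType Adj r x S: the subgraph of (V , Adj) induced by the nodes at
-- distance at most r from x, rooted at x, is isomorphic to S.
record BallType {V : Set} (Adj : Rel V 0ℓ) (r : ℕ) (x : V) (S : RootedGraph) : Set where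
  private
    module S = RootedGraph S
  field
    embed          : Fin S.size → V
    enumerates     : Enumerates embed (Distance≤ Adj r x)
    preserves-adj  : ∀ i j → S.Adj i j ⇔ Adj (embed i) (embed j)
    preserves-root : embed S.root ≡ x

Family : Set → Set₂
Family X = Pred (Pred X 0ℓ) (lsuc 0ℓ)

record IsSigmaAlgebra {X : Set} (𝓑 : Family X) : Set₁ where
  field
    resp-≐ : ∀ {A B} → A ≐ B → A ∈ 𝓑 → B ∈ 𝓑
    U∈     : U ∈ 𝓑
    ∁∈     : ∀ {A} → A ∈ 𝓑 → ∁ A ∈ 𝓑
    ⋃∈     : ∀ {A : ℕ → Pred X 0ℓ} → (∀ n → A n ∈ 𝓑) → ⋃ ℕ A ∈ 𝓑

data Generated {X : Set} {ℓ} (𝓖 : Pred (Pred X 0ℓ) ℓ) : Pred (Pred X 0ℓ) (ℓ ⊔ lsuc 0ℓ) where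
  base   : ∀ {A} → A ∈ 𝓖 → A ∈ Generated 𝓖
  resp-≐ : ∀ {A B} → A ≐ B → A ∈ Generated 𝓖 → B ∈ Generated 𝓖
  U∈     : U ∈ Generated 𝓖
  ∁∈     : ∀ {A} → A ∈ Generated 𝓖 → ∁ A ∈ Generated 𝓖
  ⋃∈     : ∀ {A : ℕ → Pred X 0ℓ} → (∀ n → A n ∈ Generated 𝓖) → ⋃ ℕ A ∈ Generated 𝓖

Rectangle : ∀ {X Y : Set} → Family X → Family Y → Family (X × Y)
Rectangle {X} {Y} 𝓐 𝓑 R =
  Σ[ A ∈ Pred X 0ℓ ] Σ[ B ∈ Pred Y 0ℓ ] A ∈ 𝓐 × B ∈ 𝓑 × R ≐ (A ⟨×⟩ B)

_⊗_ : ∀ {X Y : Set} → Family X → Family Y → Family (X × Y)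
𝓐 ⊗ 𝓑 = Generated (Rectangle 𝓐 𝓑)

MeasurableMap : ∀ {X Y : Set} → Family X → Family Y → (X → Y) → Set₁
MeasurableMap 𝓐 𝓑 f = ∀ {B} → B ∈ 𝓑 → (f ⊢ B) ∈ 𝓐

-- Everything from here on takes place in classical mathematics: excluded middle
-- supplies the case distinctions in indicators, cardinalities and suprema.

module Classical (lem : ∀ {ℓ} → ExcludedMiddle ℓ) (ℝ : CompleteOrderedField) where

  open CompleteOrderedField ℝ

  indicator : ∀ {X : Set} → Pred X 0ℓ → X → Carrier
  indicator A x with lem {P = A x}
  ... | yes _ = 1#
  ... | no  _ = 0#

  -- nothing stands for ∞
  cardinality : ∀ {X : Set} → Pred X 0ℓ → Maybe ℕ
  cardinality P with lem {P = ∃ (HasSize P)}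
  ... | yes (n , _) = just n
  ... | no  _       = nothing

  reciprocal : Maybe ℕ → Carrier
  reciprocal (just n) = fromℕ n ⁻¹
  reciprocal nothing  = 0#

  -- The value at ∞ is immaterial: this is only applied to degrees in graphs of
  -- bounded degree.
  finiteValue : Maybe ℕ → Carrier
  finiteValue (just n) = fromℕ n
  finiteValue nothing  = 0#

  module _ {X : Set} (d : X → X → Carrier) where

    record IsPolishMetric : Set where
      field
        nonneg    : ∀ x y → 0# ≤ d x y
        zero⇔≡    : ∀ x y → d x y ≈ 0# ⇔ x ≡ y
        symmetric : ∀ x y → d x y ≈ d y x
        triangle  : ∀ x y z → d x z ≤ d x y + d y z
        separable : Σ[ s ∈ (ℕ → X) ] ∀ x ε → 0# < ε → ∃[ n ] d (s n) x < ε
        complete  : (s : ℕ → X) →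
                    (∀ ε → 0# < ε → ∃[ N ] ∀ m n → N ℕ.≤ m → N ℕ.≤ n → d (s m) (s n) < ε) →
                    ∃[ x ] Tendsto (λ n → d (s n) x) 0#

    Open : Pred (Pred X 0ℓ) 0ℓ
    Open A = ∀ x → x ∈ A → ∃[ ε ] 0# < ε × (∀ y → d x y < ε → y ∈ A)

  -- Separability by a sequence excludes the empty space, which carries no
  -- probability measure.
  IsStandardBorel : ∀ {X : Set} → Family X → Set₁
  IsStandardBorel {X} 𝓑 =
    Σ[ d ∈ (X → X → Carrier) ] IsPolishMetric d × 𝓑 ≐ Generated (Open d)

  -- μ is a total function on subsets, but only its values on 𝓑 are constrained
  -- and meaningful.
  record IsProbability {X : Set} (𝓑 : Family X) (μ : Pred X 0ℓ → Carrier) : Set₁ where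
    field
      isSigmaAlgebra : IsSigmaAlgebra 𝓑
      μ-cong   : ∀ {A B} → A ∈ 𝓑 → B ∈ 𝓑 → A ≐ B → μ A ≈ μ B
      μ-nonneg : ∀ {A} → A ∈ 𝓑 → 0# ≤ μ A
      μ-total  : μ U ≈ 1#
      μ-⋃      : ∀ {A : ℕ → Pred X 0ℓ} → (∀ n → A n ∈ 𝓑) →
                 (∀ m n x → x ∈ A m → x ∈ A n → m ≡ n) →
                 Tendsto (λ n → ∑ {n} (λ i → μ (A (toℕ i)))) (μ (⋃ ℕ A))

  MeasurableFunction : ∀ {X : Set} → Family X → (X → Carrier) → Set₁
  MeasurableFunction 𝓑 f = ∀ a → (λ x → a ≤ f x) ∈ 𝓑

  module _ {X : Set} (𝓑 : Family X) (μ : Pred X 0ℓ → Carrier) where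

    -- LowerSum f v: v is the integral Σᵢ cᵢ μ(Aᵢ) of some nonnegative simple
    -- function Σᵢ cᵢ 1_{Aᵢ} lying below f.
    LowerSum : (X → Carrier) → Pred Carrier (lsuc 0ℓ)
    LowerSum f v =
      ∃[ n ] Σ[ c ∈ (Fin n → Carrier) ] Σ[ A ∈ (Fin n → Pred X 0ℓ) ]
        (∀ i → 0# ≤ c i) × (∀ i → A i ∈ 𝓑) ×
        (∀ x → ∑ (λ i → c i * indicator (A i) x) ≤ f x) ×
        v ≈ ∑ (λ i → c i * μ (A i))

    -- The Lebesgue integral of a nonnegative function, as the supremum of its
    -- lower sums.  It is applied to bounded functions only, so the supremum
    -- exists and the value 0 in the other case is immaterial.
    ∫ : (X → Carrier) → Carrier
    ∫ f with lem {P = ∃ (IsSupremum (LowerSum f))}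
    ... | yes (v , _) = v
    ... | no  _       = 0#

    ∫[_] : Pred X 0ℓ → (X → Carrier) → Carrier
    ∫[ A ] f = ∫ (λ x → indicator A x * f x)

  -- Independent random elements x₁, …, x_k of X, defined on (Ω , 𝓕 , P) and
  -- each with distribution μ.
  record IndependentSample {X Ω : Set} (𝓑 : Family X) (μ : Pred X 0ℓ → Carrier)
                           (𝓕 : Family Ω) (P : Pred Ω 0ℓ → Carrier)
                           {k : ℕ} (x : Fin k → Ω → X) : Set₁ where
    field
      measurable : ∀ i → MeasurableMap 𝓕 𝓑 (x i)
      law        : ∀ i {A} → A ∈ 𝓑 → P (x i ⊢ A) ≈ μ A
      joint      : (A : Fin k → Pred X 0ℓ) → (∀ i → A i ∈ 𝓑) →
                   P (⋂ (Fin k) (λ i → x i ⊢ A i)) ≈ ∏ (λ i → P (x i ⊢ A i))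

  record Graphing : Set₂ where
    field
      J               : Set
      𝓑               : Family J
      isStandardBorel : IsStandardBorel 𝓑
      λ′              : Pred J 0ℓ → Carrier
      isProbability   : IsProbability 𝓑 λ′
      E               : Pred (J × J) 0ℓ
      E-borel         : E ∈ (𝓑 ⊗ 𝓑)

    Adj : Rel J 0ℓ
    Adj x y = E (x , y)

    field
      E-sym     : Symmetric Adj
      E-irrefl  : Irreflexive _≡_ Adj
      E-bounded : ∃[ D ] DegreesBoundedBy Adj D

    deg : Pred J 0ℓ → J → Carrier
    deg B x = finiteValue (cardinality (Neighbours Adj x ∩ B))

    field
      -- Makes the integrals below meaningful.  This is automatic for Borel
      -- graphs of bounded degree, by the Lusin–Novikov theorem.
      deg-measurable : ∀ {B} → B ∈ 𝓑 → MeasurableFunction 𝓑 (deg B)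
      invariant      : ∀ {A B} → A ∈ 𝓑 → B ∈ 𝓑 →
                       ∫[_] 𝓑 λ′ A (deg B) ≈ ∫[_] 𝓑 λ′ B (deg A)

  GraphingParameter : Set₂
  GraphingParameter = Graphing → Carrier

  LocallyEstimable : GraphingParameter → Set₂
  LocallyEstimable f =
    ∀ ε → 0# < ε → ∀ D →
    ∃[ k ] ∃[ r ] 1 ℕ.≤ k × 1 ℕ.≤ r ×
    Σ[ estimate ∈ ((Fin k → RootedGraph) → Carrier) ]
      (∀ S S′ → (∀ i → S i ≅ S′ i) → estimate S ≈ estimate S′) ×
      ((𝐆 : Graphing) → let open Graphing 𝐆 in
       DegreesBoundedBy Adj D →
       (Ω : Set) (𝓕 : Family Ω) (P : Pred Ω 0ℓ → Carrier) → IsProbability 𝓕 P →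
       (x : Fin k → Ω → J) → IndependentSample 𝓑 λ′ 𝓕 P x →
       let bad = λ ω → Σ[ S ∈ (Fin k → RootedGraph) ]
                         (∀ i → BallType Adj r (x i ω) (S i)) ×
                         ε ≤ ∣ estimate S - f 𝐆 ∣
       in bad ∈ 𝓕 × P bad ≤ ε)

  totalRank : GraphingParameter
  totalRank 𝐆 = 1# - ∫ 𝓑 λ′ (λ u → reciprocal (cardinality (Component Adj u)))
    where open Graphing 𝐆

  module _ (G : FiniteGraph) where
    open FiniteGraph G

    uniformMean : (Fin size → Carrier) → Carrier
    uniformMean f = fromℕ size ⁻¹ * ∑ f

    uniformProb : Pred (Fin size) 0ℓ → Carrier
    uniformProb A = uniformMean (indicator A)

    finiteTotalRank : Carrier
    finiteTotalRank = 1# - uniformMean (λ u → reciprocal (cardinality (Component Adj u)))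

  LocallyConverges : (ℕ → FiniteGraph) → Graphing → Set
  LocallyConverges G 𝐆 =
    ∀ r → 1 ℕ.≤ r → ∀ S →
    Tendsto (λ n → uniformProb (G n) (λ u → BallType (FiniteGraph.Adj (G n)) r u S))
            (λ′ (λ u → BallType Adj r u S))
    where open Graphing 𝐆

{-# OPTIONS --safe #-}
module Submission where

-- The size of the component of u can be read off the r-ball around u as long as
-- it is at most r: if the ball has at most r nodes, one of the spheres of radius
-- 1, …, r is empty and the ball is the whole component.  Hence the reciprocal of
-- the component size is within 1/(r + 1) of its truncation, the function which
-- vanishes at components with more than r nodes, and this truncation is a finite
-- linear combination of indicators of isomorphism types of r-balls.  So its mean
-- converges along locally convergent sequences, and by Chebyshev's inequality it
-- is estimated by the average over independent samples.  Ball types are Borel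
-- because countably many Borel maps suffice to enumerate closed neighbourhoods.

open import Defs
open import Level using (0ℓ; Lift; lift) renaming (suc to lsuc)
open import Algebra.Bundles using (CommutativeRing; CommutativeMonoid)
import Algebra.Properties.CommutativeMonoid.Sum as CommutativeMonoidSum
import Algebra.Properties.Ring as RingProperties
import Algebra.Properties.Semiring.Mult.TCOptimised as SemiringMult
import Algebra.Properties.Semiring.Sum as SemiringSum
import Algebra.Solver.Ring as RingSolver
open import Algebra.Solver.Ring.AlmostCommutativeRing using (fromCommutativeRing; _-Raw-AlmostCommutative⟶_)
open import Axiom.ExcludedMiddle using (ExcludedMiddle)
open import Data.Bool using (Bool; true; false; T; not; _∧_; _∨_; if_then_else_)
open import Data.Bool.Properties using (T?; ∨-comm; ∨-idem)
open import Data.Empty using (⊥; ⊥-elim)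
open import Data.Fin as Fin using (Fin; zero; suc; toℕ; finToFun; funToFin)
open import Data.Fin.Permutation using (↔⇒≡)
import Data.Fin.Properties as Fin
open import Data.Integer as ℤ using (ℤ; -[1+_]; _⊖_; _◃_)
import Data.Integer.Properties as ℤ
open import Data.List as List using (List; []; _∷_; _++_; allFin; cartesianProduct)
open import Data.List.Membership.Propositional using () renaming (_∈_ to _∈ˡ_)
open import Data.List.Membership.Propositional.Properties using (∈-concat⁺′; ∈-tabulate⁺; ∈-tabulate⁻; ∈-allFin; ∈-map⁺; ∈-cartesianProduct⁺)
open import Data.List.Relation.Unary.Any as Any using (Any; here; there)
import Data.List.Relation.Unary.Any.Properties as Any
open import Data.Maybe using (Maybe; just; nothing)
open import Data.Nat as ℕ using (ℕ; zero; suc; _^_)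
import Data.Nat.Properties as ℕ
open import Data.Product using (∃; Σ-syntax; ∃-syntax; _×_; _,_; proj₁; proj₂)
open import Data.Sign as Sign using (Sign)
open import Data.Sum using (_⊎_; inj₁; inj₂)
open import Data.Unit using (tt)
open import Data.Vec as Vec using (Vec; []; _∷_; lookup; tabulate)
import Data.Vec.Functional as Vector
open import Data.Vec.Properties using (lookup∘tabulate)
open import Function using (_∘_; _⇔_; mk⇔; mk↔ₛ′; Inverse; Equivalence; Injective)
open import Function.Construct.Composition using () renaming (inverse to _∘↔_)
open import Relation.Binary using (Rel; Poset; IsTotalOrder; Symmetric; Irreflexive)
open import Relation.Binary.Construct.Closure.ReflexiveTransitive using (Star; _◅_) renaming (ε to nil)
open import Relation.Binary.PropositionalEquality as ≡ using (_≡_)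
open import Relation.Nullary using (Dec; ¬_; yes; no; does)
open import Relation.Nullary.Decidable using (does-⇔; dec-true; dec-false)
open import Relation.Unary using (Pred; _∈_; _∩_; _∪_; ∁; U; ⋃; ⋂; _⊢_)

open Equivalence using (to; from)

-- Two obstacles shape the proof. Having a given ball type is an existential statement about points,
-- hence a projection, and projections of Borel sets are not Borel in general. Everything is
-- therefore traced back to degrees: the points with a neighbour in B are those where `deg B` is at
-- least 1, and such sets yield maps that turn quantifiers over points into quantifiers over
-- countable index sets. Moreover, the reciprocal of the component size is not a simple function;
-- but it is squeezed between two simple functions, and the integral, a supremum of lower sums,
-- inherits the squeeze. So a calculus of means is developed for simple functions only.
--
-- The constants: ε is halved into η + η. One half pays for the truncation, 1/(r + 1) ≤ η, the other
-- for the sampling or for the convergence. The truncation takes values in [0, 1], so the sum of k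
-- independent samples has variance at most k, and Chebyshev bounds the probability of failure by
-- k/(kη)² = 1/(kη²), which is at most ε as soon as k ≥ 1/(η²ε).

-- Integer coefficients for the ring solver

module IntegerCoefficients (R : CommutativeRing 0ℓ 0ℓ) where

  open CommutativeRing R
  open SemiringMult semiring
    using (1+×; ×-homo-+; ×1-homo-*) renaming (_×_ to _·_)
  open RingProperties ring
    using (-‿distribˡ-*; -‿distribʳ-*; -0#≈0#; -‿involutive; -‿+-comm)
  open import Relation.Binary.Reasoning.Setoid setoid

  ⟦_⟧ : ℤ → Carrier
  ⟦ ℤ.+ n    ⟧ = n · 1#
  ⟦ -[1+ n ] ⟧ = - (suc n · 1#)

  ⊖-homo : ∀ m n → ⟦ m ⊖ n ⟧ ≈ m · 1# - n · 1#
  ⊖-homo m       zero    = sym (trans (+-congˡ -0#≈0#) (+-identityʳ _))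
  ⊖-homo zero    (suc n) = sym (+-identityˡ _)
  ⊖-homo (suc m) (suc n) = begin
    ⟦ suc m ⊖ suc n ⟧                ≡⟨ ≡.cong ⟦_⟧ (ℤ.[1+m]⊖[1+n]≡m⊖n m n) ⟩
    ⟦ m ⊖ n ⟧                        ≈⟨ ⊖-homo m n ⟩
    m · 1# - n · 1#                  ≈⟨ +-congʳ (+-identityʳ _) ⟨
    (m · 1# + 0#) - n · 1#           ≈⟨ +-congʳ (+-congˡ (-‿inverseʳ 1#)) ⟨
    (m · 1# + (1# - 1#)) - n · 1#    ≈⟨ +-congʳ (+-assoc _ _ _) ⟨
    ((m · 1# + 1#) - 1#) - n · 1#    ≈⟨ +-assoc _ _ _ ⟩
    (m · 1# + 1#) + (- 1# - n · 1#)  ≈⟨ +-cong (+-comm _ _) (-‿+-comm _ _) ⟩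
    (1# + m · 1#) - (1# + n · 1#)    ≈⟨ +-cong (1+× m 1#) (-‿cong (1+× n 1#)) ⟨
    suc m · 1# - suc n · 1#          ∎

  +-homo : ∀ i j → ⟦ i ℤ.+ j ⟧ ≈ ⟦ i ⟧ + ⟦ j ⟧
  +-homo (ℤ.+ m)  (ℤ.+ n)  = ×-homo-+ 1# m n
  +-homo (ℤ.+ m)  -[1+ n ] = ⊖-homo m (suc n)
  +-homo -[1+ m ] (ℤ.+ n)  = trans (⊖-homo n (suc m)) (+-comm _ _)
  +-homo -[1+ m ] -[1+ n ] = begin
    - (suc (suc (m ℕ.+ n)) · 1#)       ≡⟨ ≡.cong (λ k → - (suc k · 1#)) (ℕ.+-suc m n) ⟨
    - ((suc m ℕ.+ suc n) · 1#)         ≈⟨ -‿cong (×-homo-+ 1# (suc m) (suc n)) ⟩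
    - (suc m · 1# + suc n · 1#)        ≈⟨ -‿+-comm _ _ ⟨
    - (suc m · 1#) + - (suc n · 1#)    ∎

  neg-homo : ∀ i → ⟦ ℤ.- i ⟧ ≈ - ⟦ i ⟧
  neg-homo (ℤ.+ zero)  = sym -0#≈0#
  neg-homo (ℤ.+ suc n) = refl
  neg-homo -[1+ n ]    = sym (-‿involutive _)

  -◃-homo : ∀ n → ⟦ Sign.- ◃ n ⟧ ≈ - (n · 1#)
  -◃-homo zero    = sym -0#≈0#
  -◃-homo (suc n) = refl

  +◃-homo : ∀ n → ⟦ Sign.+ ◃ n ⟧ ≈ n · 1#
  +◃-homo zero    = refl
  +◃-homo (suc n) = refl

  *-homo : ∀ i j → ⟦ i ℤ.* j ⟧ ≈ ⟦ i ⟧ * ⟦ j ⟧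
  *-homo (ℤ.+ m)  (ℤ.+ n)  = trans (+◃-homo (m ℕ.* n)) (×1-homo-* m n)
  *-homo (ℤ.+ m)  -[1+ n ] = begin
    ⟦ Sign.- ◃ m ℕ.* suc n ⟧   ≈⟨ -◃-homo (m ℕ.* suc n) ⟩
    - ((m ℕ.* suc n) · 1#)     ≈⟨ -‿cong (×1-homo-* m (suc n)) ⟩
    - (m · 1# * suc n · 1#)    ≈⟨ -‿distribʳ-* _ _ ⟩
    m · 1# * - (suc n · 1#)    ∎
  *-homo -[1+ m ] (ℤ.+ n)  = begin
    ⟦ Sign.- ◃ suc m ℕ.* n ⟧   ≈⟨ -◃-homo (suc m ℕ.* n) ⟩
    - ((suc m ℕ.* n) · 1#)     ≈⟨ -‿cong (×1-homo-* (suc m) n) ⟩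
    - (suc m · 1# * n · 1#)    ≈⟨ -‿distribˡ-* _ _ ⟩
    - (suc m · 1#) * n · 1#    ∎
  *-homo -[1+ m ] -[1+ n ] = begin
    ⟦ Sign.+ ◃ suc m ℕ.* suc n ⟧      ≈⟨ +◃-homo (suc m ℕ.* suc n) ⟩
    (suc m ℕ.* suc n) · 1#            ≈⟨ ×1-homo-* (suc m) (suc n) ⟩
    suc m · 1# * suc n · 1#           ≈⟨ -‿involutive _ ⟨
    - - (suc m · 1# * suc n · 1#)     ≈⟨ -‿cong (-‿distribʳ-* _ _) ⟩
    - (suc m · 1# * - (suc n · 1#))   ≈⟨ -‿distribˡ-* _ _ ⟩
    - (suc m · 1#) * - (suc n · 1#)   ∎

  morphism : ℤ.+-*-rawRing -Raw-AlmostCommutative⟶ fromCommutativeRing R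
  morphism = record
    { ⟦_⟧    = ⟦_⟧
    ; +-homo = +-homo
    ; *-homo = *-homo
    ; -‿homo = neg-homo
    ; 0-homo = refl
    ; 1-homo = refl
    }

  -- Equality of reals is not decidable by computation, whereas equality of integers is; comparing
  -- integer coefficients lets the solver cancel terms.
  coeff≟ : ∀ i j → Maybe (⟦ i ⟧ ≈ ⟦ j ⟧)
  coeff≟ i j with i ℤ.≟ j
  ... | yes i≡j = just (reflexive (≡.cong ⟦_⟧ i≡j))
  ... | no  _   = nothing

  open RingSolver ℤ.+-*-rawRing (fromCommutativeRing R) morphism coeff≟ public
    using (Polynomial; solve; con; _:=_; _:+_; _:*_; _:-_; :-_)

-- Finite sums with at most two nontrivial terms

module SparseSums (M : CommutativeMonoid 0ℓ 0ℓ) where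
  private
    module M = CommutativeMonoid M
  open CommutativeMonoidSum M using (sum; sum-cong-≋; sum-replicate-zero)

  sum-zero : ∀ {n} {h : Fin n → M.Carrier} → (∀ i → h i M.≈ M.ε) → sum h M.≈ M.ε
  sum-zero {n} h≈ε = M.trans (sum-cong-≋ h≈ε) (sum-replicate-zero n)

  sum-single : ∀ {n} {h : Fin n → M.Carrier} i → (∀ j → ¬ i ≡ j → h j M.≈ M.ε) → sum h M.≈ h i
  sum-single {suc n} zero    rest = M.trans (M.∙-congˡ (sum-zero (λ j → rest (suc j) λ ()))) (M.identityʳ _)
  sum-single {suc n} (suc i) rest = M.trans (M.∙-congʳ (rest zero λ ()))
    (M.trans (M.identityˡ _) (sum-single i λ j i≢j → rest (suc j) λ { ≡.refl → i≢j ≡.refl }))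

  -- Meant for the multiplicative monoid: in the joint law of a sample, all factors but two are 1.
  sum-pair : ∀ {n} {h : Fin n → M.Carrier} i j → ¬ i ≡ j →
             (∀ l → ¬ i ≡ l → ¬ j ≡ l → h l M.≈ M.ε) → sum h M.≈ h i M.∙ h j
  sum-pair {suc n} zero    zero    i≢j rest = ⊥-elim (i≢j ≡.refl)
  sum-pair {suc n} zero    (suc j) i≢j rest =
    M.∙-congˡ (sum-single j λ l j≢l → rest (suc l) (λ ()) λ { ≡.refl → j≢l ≡.refl })
  sum-pair {suc n} (suc i) zero    i≢j rest = M.trans
    (M.∙-congˡ (sum-single i λ l i≢l → rest (suc l) (λ { ≡.refl → i≢l ≡.refl }) λ ())) (M.comm _ _)
  sum-pair {suc n} (suc i) (suc j) i≢j rest = M.trans (M.∙-congʳ (rest zero (λ ()) λ ()))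
    (M.trans (M.identityˡ _) (sum-pair i j (λ { ≡.refl → i≢j ≡.refl })
      λ l i≢l j≢l → rest (suc l) (λ { ≡.refl → i≢l ≡.refl }) λ { ≡.refl → j≢l ≡.refl }))

-- Ordered-field arithmetic, absolute values and limits

module OrderedField (lem : ∀ {ℓ} → ExcludedMiddle ℓ) (ℝ : CompleteOrderedField) where

  open CompleteOrderedField ℝ hiding (zero)
  open IntegerCoefficients commutativeRing public using (Polynomial; solve; con; _:=_; _:+_; _:*_; _:-_; :-_)

  poset : Poset 0ℓ 0ℓ 0ℓ
  poset = record { isPartialOrder = isPartialOrder }
    where open IsTotalOrder isTotalOrder

  open Poset poset public using (≤-respˡ-≈; ≤-respʳ-≈) renaming
    (refl to ≤-refl; reflexive to ≤-reflexive; trans to ≤-trans; antisym to ≤-antisym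
    )

  :0 :1 : ∀ {n} → Polynomial n
  :0 = con (ℤ.+ 0)
  :1 = con (ℤ.+ 1)

  gap : ∀ {x y} → x ≤ y → 0# ≤ y - x
  gap {x} {y} x≤y = ≤-respˡ-≈ (-‿inverseˡ x) (≤-respʳ-≈ (+-comm _ _) (+-monoʳ-≤ (- x) x≤y))

  -- Inequalities are proved by exhibiting the difference of the two sides as a
  -- combination of nonnegative terms.
  ≤-by : ∀ {x y z} → 0# ≤ z → y - x ≈ z → x ≤ y
  ≤-by {x} {y} 0≤z y-x≈z =
    ≤-respˡ-≈ (+-identityʳ x) (≤-respʳ-≈ x+[y-x]≈y (+-monoʳ-≤ x (≤-respʳ-≈ (sym y-x≈z) 0≤z)))
    where
    x+[y-x]≈y : x + (y - x) ≈ y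
    x+[y-x]≈y = solve 2 (λ x y → x :+ (y :- x) := y) refl x y

  +-nonneg : ∀ {x y} → 0# ≤ x → 0# ≤ y → 0# ≤ x + y
  +-nonneg {x} 0≤x 0≤y = ≤-trans 0≤x (≤-respˡ-≈ (+-identityʳ x) (+-monoʳ-≤ x 0≤y))

  +-mono-≤ : ∀ {x y u v} → x ≤ y → u ≤ v → x + u ≤ y + v
  +-mono-≤ {x} {y} {u} {v} x≤y u≤v = ≤-by (+-nonneg (gap x≤y) (gap u≤v))
    (solve 4 (λ x y u v → (y :+ v) :- (x :+ u) := (y :- x) :+ (v :- u)) refl x y u v)

  *-monoˡ-≤ : ∀ {c x y} → 0# ≤ c → x ≤ y → c * x ≤ c * y
  *-monoˡ-≤ {c} {x} {y} 0≤c x≤y = ≤-by (*-nonneg 0≤c (gap x≤y))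
    (solve 3 (λ c x y → (c :* y) :- (c :* x) := c :* (y :- x)) refl c x y)

  ≰⇒< : ∀ {x y} → ¬ y ≤ x → x < y
  ≰⇒< {x} {y} y≰x with total x y
  ... | inj₁ x≤y = x≤y , λ x≈y → y≰x (≤-reflexive (sym x≈y))
  ... | inj₂ y≤x = ⊥-elim (y≰x y≤x)

  <⇒≱ : ∀ {x y} → x < y → ¬ y ≤ x
  <⇒≱ (x≤y , x≉y) y≤x = x≉y (≤-antisym x≤y y≤x)

  <-≤-trans : ∀ {x y z} → x < y → y ≤ z → x < z
  <-≤-trans x<y y≤z = ≰⇒< λ z≤x → <⇒≱ x<y (≤-trans y≤z z≤x)

  ≤-<-trans : ∀ {x y z} → x ≤ y → y < z → x < z
  ≤-<-trans x≤y y<z = ≰⇒< λ z≤x → <⇒≱ y<z (≤-trans z≤x x≤y)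

  square-nonneg : ∀ x → 0# ≤ x * x
  square-nonneg x with total 0# x
  ... | inj₁ 0≤x = *-nonneg 0≤x 0≤x
  ... | inj₂ x≤0 = ≤-respʳ-≈ (solve 1 (λ x → (:0 :- x) :* (:0 :- x) := x :* x) refl x)
                     (*-nonneg (gap x≤0) (gap x≤0))

  0<1 : 0# < 1#
  0<1 = ≤-respʳ-≈ (*-identityʳ 1#) (square-nonneg 1#) , 0≉1

  0≤1 : 0# ≤ 1#
  0≤1 = proj₁ 0<1

  +-pos-nonneg : ∀ {x y} → 0# < x → 0# ≤ y → 0# < x + y
  +-pos-nonneg {x} 0<x 0≤y = <-≤-trans 0<x (≤-respˡ-≈ (+-identityʳ x) (+-monoʳ-≤ x 0≤y))

  *-pos : ∀ {x y} → 0# < x → 0# < y → 0# < x * y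
  *-pos {x} {y} (0≤x , 0≉x) (0≤y , 0≉y) = *-nonneg 0≤x 0≤y , λ 0≈xy → 0≉y (begin
    0#               ≈⟨ zeroʳ (x ⁻¹) ⟨
    x ⁻¹ * 0#        ≈⟨ *-congˡ 0≈xy ⟩
    x ⁻¹ * (x * y)   ≈⟨ solve 3 (λ i x y → i :* (x :* y) := (x :* i) :* y) refl (x ⁻¹) x y ⟩
    (x * x ⁻¹) * y   ≈⟨ *-congʳ (⁻¹-inverseʳ (λ x≈0 → 0≉x (sym x≈0))) ⟩
    1# * y           ≈⟨ *-identityˡ y ⟩
    y                ∎)
    where open import Relation.Binary.Reasoning.Setoid setoid

  ⁻¹-inverse-pos : ∀ {x} → 0# < x → x * x ⁻¹ ≈ 1#
  ⁻¹-inverse-pos (_ , 0≉x) = ⁻¹-inverseʳ (λ x≈0 → 0≉x (sym x≈0))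

  ⁻¹-nonneg : ∀ {x} → 0# < x → 0# ≤ x ⁻¹
  ⁻¹-nonneg {x} 0<x with total 0# (x ⁻¹)
  ... | inj₁ 0≤x⁻¹ = 0≤x⁻¹
  ... | inj₂ x⁻¹≤0 = ⊥-elim (<⇒≱ 0<1 (≤-by (*-nonneg (proj₁ 0<x) (gap x⁻¹≤0))
        (begin
          0# - 1#          ≈⟨ +-congˡ (-‿cong (⁻¹-inverse-pos 0<x)) ⟨
          0# - x * x ⁻¹    ≈⟨ solve 2 (λ x i → :0 :- x :* i := x :* (:0 :- i)) refl x (x ⁻¹) ⟩
          x * (0# - x ⁻¹)  ∎)))
    where open import Relation.Binary.Reasoning.Setoid setoid

  ⁻¹-pos : ∀ {x} → 0# < x → 0# < x ⁻¹
  ⁻¹-pos {x} 0<x = ⁻¹-nonneg 0<x , λ 0≈x⁻¹ → 0≉1 (begin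
    0#         ≈⟨ zeroʳ x ⟨
    x * 0#     ≈⟨ *-congˡ 0≈x⁻¹ ⟩
    x * x ⁻¹   ≈⟨ ⁻¹-inverse-pos 0<x ⟩
    1#         ∎)
    where open import Relation.Binary.Reasoning.Setoid setoid

  *-cancelˡ-≤ : ∀ {c x y} → 0# < c → c * x ≤ c * y → x ≤ y
  *-cancelˡ-≤ {c} {x} {y} 0<c cx≤cy =
    ≤-respˡ-≈ (undo x) (≤-respʳ-≈ (undo y) (*-monoˡ-≤ (⁻¹-nonneg 0<c) cx≤cy))
    where
    open import Relation.Binary.Reasoning.Setoid setoid
    undo : ∀ z → c ⁻¹ * (c * z) ≈ z
    undo z = begin
      c ⁻¹ * (c * z)   ≈⟨ solve 3 (λ i c z → i :* (c :* z) := (c :* i) :* z) refl (c ⁻¹) c z ⟩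
      (c * c ⁻¹) * z   ≈⟨ *-congʳ (⁻¹-inverse-pos 0<c) ⟩
      1# * z           ≈⟨ *-identityˡ z ⟩
      z                ∎

  ⁻¹-anti-≤ : ∀ {x y} → 0# < x → x ≤ y → y ⁻¹ ≤ x ⁻¹
  ⁻¹-anti-≤ {x} {y} 0<x x≤y = *-cancelˡ-≤ 0<x (*-cancelˡ-≤ 0<y
    (≤-respˡ-≈ (sym (begin
        y * (x * y ⁻¹)  ≈⟨ solve 3 (λ y x j → y :* (x :* j) := (y :* j) :* x) refl y x (y ⁻¹) ⟩
        (y * y ⁻¹) * x  ≈⟨ *-congʳ (⁻¹-inverse-pos 0<y) ⟩
        1# * x          ≈⟨ *-identityˡ x ⟩
        x               ∎))
    (≤-respʳ-≈ (sym (begin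
        y * (x * x ⁻¹)  ≈⟨ *-congˡ (⁻¹-inverse-pos 0<x) ⟩
        y * 1#          ≈⟨ *-identityʳ y ⟩
        y               ∎))
      x≤y)))
    where
    open import Relation.Binary.Reasoning.Setoid setoid
    0<y : 0# < y
    0<y = <-≤-trans 0<x x≤y

  fromℕ-nonneg : ∀ n → 0# ≤ fromℕ n
  fromℕ-nonneg zero    = ≤-refl
  fromℕ-nonneg (suc n) = +-nonneg 0≤1 (fromℕ-nonneg n)

  fromℕ-pos : ∀ n → 0# < fromℕ (suc n)
  fromℕ-pos n = +-pos-nonneg 0<1 (fromℕ-nonneg n)

  fromℕ-mono : ∀ {m n} → m ℕ.≤ n → fromℕ m ≤ fromℕ n
  fromℕ-mono {n = n} ℕ.z≤n = fromℕ-nonneg n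
  fromℕ-mono (ℕ.s≤s m≤n) = +-monoʳ-≤ 1# (fromℕ-mono m≤n)

  -- If the naturals were bounded, they would have a supremum s; since n + 1 ≤ s for every n, also s
  -- - 1 would be an upper bound, contradicting leastness.
  archimedean : ∀ x → ∃[ n ] x ≤ fromℕ n
  archimedean x with lem {P = ∃[ n ] x ≤ fromℕ n}
  ... | yes found = found
  ... | no  none  = ⊥-elim (<⇒≱ 0<1 (≤-by (gap (least s-1-bound))
        (solve 1 (λ s → :0 :- :1 := (s :- :1) :- s) refl s)))
    where
    -- `Lift` moves the predicate into the universe for which completeness is stated.
    Natural : Carrier → Set₁
    Natural y = Lift (lsuc 0ℓ) (∃[ n ] y ≈ fromℕ n)
    x-bound : IsUpperBound Natural x
    x-bound (lift (n , y≈n)) with total _ x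
    ... | inj₁ y≤x = y≤x
    ... | inj₂ x≤y = ⊥-elim (none (n , ≤-respʳ-≈ y≈n x≤y))
    supremum : ∃ (IsSupremum Natural)
    supremum = complete Natural (0# , lift (0 , refl)) (x , x-bound)
    s : Carrier
    s = proj₁ supremum
    least : ∀ {b} → IsUpperBound Natural b → s ≤ b
    least = proj₂ (proj₂ supremum)
    s-1-bound : IsUpperBound Natural (s - 1#)
    s-1-bound (lift (n , y≈n)) = ≤-respˡ-≈ (sym y≈n)
      (≤-by (gap (proj₁ (proj₂ supremum) (lift (suc n , refl))))
        (solve 2 (λ s m → (s :- :1) :- m := s :- (:1 :+ m)) refl s (fromℕ n)))

  small-reciprocal : ∀ {ε} → 0# < ε → ∃[ n ] fromℕ (suc n) ⁻¹ ≤ ε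
  small-reciprocal {ε} 0<ε with archimedean (ε ⁻¹)
  ... | n , ε⁻¹≤n = n , *-cancelˡ-≤ (fromℕ-pos n)
        (≤-respˡ-≈ (trans (⁻¹-inverse-pos 0<ε) (sym (⁻¹-inverse-pos (fromℕ-pos n))))
        (≤-respʳ-≈ (*-comm ε _)
        (*-monoˡ-≤ (proj₁ 0<ε) (≤-trans ε⁻¹≤n (fromℕ-mono (ℕ.n≤1+n n))))))

  half : ∀ {ε} → 0# < ε → ∃[ η ] 0# < η × η + η ≈ ε
  half {ε} 0<ε = ε * 2# ⁻¹ , *-pos 0<ε (⁻¹-pos (fromℕ-pos 1)) , (begin
    ε * 2# ⁻¹ + ε * 2# ⁻¹   ≈⟨ solve 2 (λ ε i → ε :* i :+ ε :* i := ((:1 :+ (:1 :+ :0)) :* i) :* ε) refl ε (2# ⁻¹) ⟩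
    (2# * 2# ⁻¹) * ε        ≈⟨ *-congʳ (⁻¹-inverse-pos (fromℕ-pos 1)) ⟩
    1# * ε                  ≈⟨ *-identityˡ ε ⟩
    ε                       ∎)
    where
    open import Relation.Binary.Reasoning.Setoid setoid
    2# : Carrier
    2# = fromℕ 2

  x≤∣x∣ : ∀ x → x ≤ ∣ x ∣
  x≤∣x∣ x with total 0# x
  ... | inj₁ _   = ≤-refl
  ... | inj₂ x≤0 = ≤-by (+-nonneg (gap x≤0) (gap x≤0))
    (solve 1 (λ x → :- x :- x := (:0 :- x) :+ (:0 :- x)) refl x)

  -x≤∣x∣ : ∀ x → - x ≤ ∣ x ∣
  -x≤∣x∣ x with total 0# x
  ... | inj₁ 0≤x = ≤-by (+-nonneg 0≤x 0≤x) (solve 1 (λ x → x :- :- x := x :+ x) refl x)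
  ... | inj₂ _   = ≤-refl

  ≤∣∣-cases : ∀ {a} x → a ≤ ∣ x ∣ → a ≤ x ⊎ a ≤ - x
  ≤∣∣-cases x a≤ with total 0# x
  ... | inj₁ _ = inj₁ a≤
  ... | inj₂ _ = inj₂ a≤

  ∣∣-< : ∀ {a} x → x < a → - x < a → ∣ x ∣ < a
  ∣∣-< x x<a -x<a with total 0# x
  ... | inj₁ _ = x<a
  ... | inj₂ _ = -x<a

  ∣∣-cong : ∀ {x y} → x ≈ y → ∣ x ∣ ≈ ∣ y ∣
  ∣∣-cong {x} {y} x≈y = ≤-antisym (upper x≈y) (upper (sym x≈y))
    where
    upper : ∀ {x y} → x ≈ y → ∣ x ∣ ≤ ∣ y ∣
    upper {x} {y} x≈y with ≤∣∣-cases x ≤-refl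
    ... | inj₁ p = ≤-trans p (≤-respˡ-≈ (sym x≈y) (x≤∣x∣ y))
    ... | inj₂ p = ≤-trans p (≤-respˡ-≈ (-‿cong (sym x≈y)) (-x≤∣x∣ y))

  x≈0⇒∣x∣≈0 : ∀ {x} → x ≈ 0# → ∣ x ∣ ≈ 0#
  x≈0⇒∣x∣≈0 x≈0 = trans (∣∣-cong x≈0) (≤-antisym 0-upper (≤-respˡ-≈ refl (x≤∣x∣ 0#)))
    where
    0-upper : ∣ 0# ∣ ≤ 0#
    0-upper with ≤∣∣-cases 0# ≤-refl
    ... | inj₁ p = p
    ... | inj₂ p = ≤-respʳ-≈ (solve 0 (:- :0 := :0) refl) p

  open SemiringSum semiring public using (*-distribˡ-sum; *-distribʳ-sum)
  open CommutativeMonoidSum +-commutativeMonoid public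
    using (∑-distrib-+; ∑-comm)
    renaming (sum-cong-≋ to ∑-cong)

  ∑-mono : ∀ {n} {f g : Fin n → Carrier} → (∀ i → f i ≤ g i) → ∑ f ≤ ∑ g
  ∑-mono {zero}  f≤g = ≤-refl
  ∑-mono {suc n} f≤g = +-mono-≤ (f≤g zero) (∑-mono (λ i → f≤g (suc i)))

  ∑-nonneg : ∀ {n} {f : Fin n → Carrier} → (∀ i → 0# ≤ f i) → 0# ≤ ∑ f
  ∑-nonneg {zero}  0≤f = ≤-refl
  ∑-nonneg {suc n} 0≤f = +-nonneg (0≤f zero) (∑-nonneg (λ i → 0≤f (suc i)))

  ∑-const : ∀ n c → ∑ {n} (λ _ → c) ≈ fromℕ n * c
  ∑-const zero    c = sym (zeroˡ c)
  ∑-const (suc n) c = trans (+-cong (sym (*-identityˡ c)) (∑-const n c)) (sym (distribʳ c 1# (fromℕ n)))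

  tendsto-const : ∀ c → Tendsto (λ _ → c) c
  tendsto-const c ε 0<ε = 0 , λ _ _ → ≤-<-trans (≤-reflexive (x≈0⇒∣x∣≈0 (-‿inverseʳ c))) 0<ε

  tendsto-cong : ∀ {s t l} → (∀ n → s n ≈ t n) → Tendsto s l → Tendsto t l
  tendsto-cong s≈t s→l ε 0<ε with s→l ε 0<ε
  ... | N , close = N , λ n N≤n →
    ≤-<-trans (≤-reflexive (∣∣-cong (+-congʳ (sym (s≈t n))))) (close n N≤n)

  between : ∀ {x ε} → ∣ x ∣ < ε → x < ε × - x < ε
  between {x} ∣x∣<ε = ≤-<-trans (x≤∣x∣ x) ∣x∣<ε , ≤-<-trans (-x≤∣x∣ x) ∣x∣<ε

  +-mono-<-≤ : ∀ {x y u v} → x < y → u ≤ v → x + u < y + v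
  +-mono-<-≤ {x} {y} {u} {v} x<y u≤v = ≰⇒< λ y+v≤x+u → <⇒≱ x<y
    (≤-by (+-nonneg (gap y+v≤x+u) (gap u≤v))
      (solve 4 (λ x y u v → x :- y := (x :+ u :- (y :+ v)) :+ (v :- u)) refl x y u v))

  tendsto-+ : ∀ {s t l m} → Tendsto s l → Tendsto t m → Tendsto (λ n → s n + t n) (l + m)
  tendsto-+ {s} {t} {l} {m} s→l t→m ε 0<ε with half 0<ε
  ... | η , 0<η , η+η≈ε with s→l η 0<η | t→m η 0<η
  ... | M , s-close | N , t-close = M ℕ.⊔ N , λ n M⊔N≤n →
    let s< = between (s-close n (ℕ.m⊔n≤o⇒m≤o M N M⊔N≤n))
        t< = between (t-close n (ℕ.m⊔n≤o⇒n≤o M N M⊔N≤n))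
    in ∣∣-< _
      (≤-<-trans (≤-reflexive (solve 4 (λ s t l m → s :+ t :- (l :+ m) := (s :- l) :+ (t :- m)) refl (s n) (t n) l m))
        (<-≤-trans (+-mono-<-≤ (proj₁ s<) (proj₁ (proj₁ t<))) (≤-reflexive η+η≈ε)))
      (≤-<-trans (≤-reflexive (solve 4 (λ s t l m → :- (s :+ t :- (l :+ m)) := :- (s :- l) :+ :- (t :- m)) refl (s n) (t n) l m))
        (<-≤-trans (+-mono-<-≤ (proj₂ s<) (proj₁ (proj₂ t<))) (≤-reflexive η+η≈ε)))

  tendsto-* : ∀ {s l} c → 0# ≤ c → Tendsto s l → Tendsto (λ n → c * s n) (c * l)
  tendsto-* {s} {l} c 0≤c s→l ε 0<ε = proj₁ (s→l θ 0<θ) , λ n N≤n →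
    let s< = between (proj₂ (s→l θ 0<θ) n N≤n) in
    ∣∣-< _ (scale (s n - l) (solve 3 (λ c s l → c :* s :- c :* l := c :* (s :- l)) refl c (s n) l) (proj₁ s<))
           (scale (- (s n - l)) (solve 3 (λ c s l → :- (c :* s :- c :* l) := c :* :- (s :- l)) refl c (s n) l) (proj₂ s<))
    where
    open import Relation.Binary.Reasoning.Setoid setoid
    0<1+c : 0# < 1# + c
    0<1+c = +-pos-nonneg 0<1 0≤c
    -- Dividing by 1 + c instead of c covers c = 0 without a separate case.
    θ : Carrier
    θ = ε * (1# + c) ⁻¹
    0<θ : 0# < θ
    0<θ = *-pos 0<ε (⁻¹-pos 0<1+c)
    [1+c]θ≈ε : (1# + c) * θ ≈ ε
    [1+c]θ≈ε = begin
      (1# + c) * (ε * (1# + c) ⁻¹)  ≈⟨ solve 3 (λ d ε i → d :* (ε :* i) := (d :* i) :* ε) refl (1# + c) ε ((1# + c) ⁻¹) ⟩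
      ((1# + c) * (1# + c) ⁻¹) * ε  ≈⟨ *-congʳ (⁻¹-inverse-pos 0<1+c) ⟩
      1# * ε                        ≈⟨ *-identityˡ ε ⟩
      ε                             ∎
    scale : ∀ {y} x → y ≈ c * x → x < θ → y < ε
    scale {y} x y≈cx x<θ = <-≤-trans
      (≤-<-trans (≤-trans (≤-reflexive y≈cx) (*-monoˡ-≤ 0≤c (proj₁ x<θ)))
        (≰⇒< λ c+θ≤ → <⇒≱ 0<θ (≤-by (gap c+θ≤)
           (solve 2 (λ c t → :0 :- t := c :* t :- (:1 :+ c) :* t) refl c θ))))
      (≤-reflexive [1+c]θ≈ε)

  tendsto-∑ : ∀ {n} {s : Fin n → ℕ → Carrier} {l : Fin n → Carrier} →
              (∀ i → Tendsto (s i) (l i)) → Tendsto (λ m → ∑ (λ i → s i m)) (∑ l)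
  tendsto-∑ {zero}  s→l = tendsto-const 0#
  tendsto-∑ {suc n} s→l = tendsto-+ (s→l zero) (tendsto-∑ (λ i → s→l (suc i)))

  tendsto-unique : ∀ {s l m} → Tendsto s l → Tendsto s m → l ≈ m
  tendsto-unique s→l s→m = ≤-antisym (upper s→l s→m) (upper s→m s→l)
    where
    upper : ∀ {s l m} → Tendsto s l → Tendsto s m → l ≤ m
    upper {s} {l} {m} s→l s→m with total l m
    ... | inj₁ l≤m = l≤m
    ... | inj₂ m≤l with lem {P = l ≈ m}
    ... | yes l≈m = ≤-reflexive l≈m
    ... | no  l≉m with half {l - m} (gap m≤l , λ 0≈ → l≉m (begin
             l             ≈⟨ solve 2 (λ l m → l := (l :- m) :+ m) refl l m ⟩
             (l - m) + m   ≈⟨ +-congʳ 0≈ ⟨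
             0# + m        ≈⟨ +-identityˡ m ⟩
             m             ∎))
      where open import Relation.Binary.Reasoning.Setoid setoid
    ... | η , 0<η , η+η≈l-m with s→l η 0<η | s→m η 0<η
    ... | M , l-close | N , m-close =
      ⊥-elim (<⇒≱ (+-mono-<-≤ (proj₂ (between (l-close (M ℕ.⊔ N) (ℕ.m≤m⊔n M N))))
                               (proj₁ (proj₁ (between (m-close (M ℕ.⊔ N) (ℕ.m≤n⊔m M N))))))
        (≤-reflexive (trans η+η≈l-m
          (solve 3 (λ s l m → l :- m := :- (s :- l) :+ (s :- m)) refl (s (M ℕ.⊔ N)) l m))))

-- Finite sets, balls and their isomorphism types

module Combinatorics (lem : ∀ {ℓ} → ExcludedMiddle ℓ) where

  open ≡ using (refl; sym; trans; cong; cong₂; subst; subst₂)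

  by-contradiction : ∀ {ℓ} {P : Set ℓ} → ¬ ¬ P → P
  by-contradiction {P = P} ¬¬p with lem {P = P}
  ... | yes p = p
  ... | no ¬p = ⊥-elim (¬¬p ¬p)

  module _ {X : Set} where

    injection-≤ : ∀ {P : Pred X 0ℓ} {m n} → HasSize P n → (g : Fin m → X) →
                  Injective _≡_ _≡_ g → (∀ i → P (g i)) → m ℕ.≤ n
    injection-≤ (f , _ , enum) g g-inj g∈P = Fin.injective⇒≤ {f = λ i → proj₁ (index i)} λ {i} {j} eq →
      g-inj (trans (sym (proj₂ (index i))) (trans (cong f eq) (proj₂ (index j))))
      where
      index : ∀ i → ∃[ j ] f j ≡ g i
      index i = to (enum (g i)) (g∈P i)

    HasSize-mono : ∀ {P Q : Pred X 0ℓ} {m n} → (∀ x → P x → Q x) → HasSize P m → HasSize Q n → m ℕ.≤ n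
    HasSize-mono P⊆Q (g , g-inj , enum) Q-size =
      injection-≤ Q-size g g-inj λ i → P⊆Q _ (from (enum (g i)) (i , refl))

    HasSize-unique : ∀ {P : Pred X 0ℓ} {m n} → HasSize P m → HasSize P n → m ≡ n
    HasSize-unique p q = ℕ.≤-antisym (HasSize-mono (λ _ x∈P → x∈P) p q) (HasSize-mono (λ _ x∈P → x∈P) q p)

    HasSize-resp : ∀ {P Q : Pred X 0ℓ} {n} → (∀ x → P x ⇔ Q x) → HasSize P n → HasSize Q n
    HasSize-resp P⇔Q (f , f-inj , enum) = f , f-inj , λ x →
      mk⇔ (λ x∈Q → to (enum x) (from (P⇔Q x) x∈Q)) (λ i → to (P⇔Q x) (from (enum x) i))

    HasSize-elements : ∀ {P : Pred X 0ℓ} {n} → HasSize P n → ∃[ l ] (∀ x → P x → x ∈ˡ l) × (∀ x → x ∈ˡ l → P x)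
    HasSize-elements {P} (f , _ , enum) = List.tabulate f
      , (λ x x∈P → let i , fi≡x = to (enum x) x∈P in subst (_∈ˡ List.tabulate f) fi≡x (∈-tabulate⁺ {f = f} i))
      , (λ x x∈l → let i , x≡fi = ∈-tabulate⁻ {f = f} x∈l in from (enum x) (i , sym x≡fi))

    -- The list may have repetitions and elements outside P. Excluded middle drops the latter; once
    -- `a` is kept, the recursion continues with P minus `a`, so later copies of `a` are dropped as
    -- well.
    listed⇒HasSize : ∀ (l : List X) {P : Pred X 0ℓ} → (∀ x → P x → x ∈ˡ l) → ∃ (HasSize P)
    listed⇒HasSize [] {P} P⊆l = 0 , (λ ()) , (λ {}) , λ x → mk⇔ (λ x∈P → absurd (P⊆l x x∈P)) λ ()
      where
      absurd : ∀ {x} {A : Set} → x ∈ˡ [] → A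
      absurd ()
    listed⇒HasSize (a ∷ l) {P} P⊆l with lem {P = P a}
    ... | no a∉P = listed⇒HasSize l λ x x∈P → tail-∈ x x∈P (P⊆l x x∈P)
      where
      tail-∈ : ∀ x → P x → x ∈ˡ a ∷ l → x ∈ˡ l
      tail-∈ x x∈P (here refl)  = ⊥-elim (a∉P x∈P)
      tail-∈ x x∈P (there x∈l) = x∈l
    ... | yes a∈P with listed⇒HasSize l {λ x → P x × ¬ a ≡ x} tail-∈
      where
      tail-∈ : ∀ x → P x × ¬ a ≡ x → x ∈ˡ l
      tail-∈ x (x∈P , a≢x) with P⊆l x x∈P
      ... | here refl  = ⊥-elim (a≢x refl)
      ... | there x∈l = x∈l
    ... | n , f , f-inj , enum = suc n , a Vector.∷ f , inj , λ x → mk⇔ (find x) (found x)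
      where
      a≢f : ∀ i → ¬ a ≡ f i
      a≢f i = proj₂ (from (enum (f i)) (i , refl))
      inj : Injective _≡_ _≡_ (a Vector.∷ f)
      inj {zero}  {zero}  _     = refl
      inj {zero}  {suc j} a≡fj  = ⊥-elim (a≢f j a≡fj)
      inj {suc i} {zero}  fi≡a  = ⊥-elim (a≢f i (sym fi≡a))
      inj {suc i} {suc j} fi≡fj = cong suc (f-inj fi≡fj)
      find : ∀ x → P x → ∃[ i ] (a Vector.∷ f) i ≡ x
      find x x∈P with lem {P = a ≡ x}
      ... | yes a≡x = zero , a≡x
      ... | no  a≢x = let i , fi≡x = to (enum x) (x∈P , a≢x) in suc i , fi≡x
      found : ∀ x → ∃[ i ] (a Vector.∷ f) i ≡ x → P x
      found x (zero  , refl) = a∈P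
      found x (suc i , fi≡x) = proj₁ (from (enum x) (i , fi≡x))

    nonempty-size : ∀ {P : Pred X 0ℓ} {n} → HasSize P n → ∃ P → 1 ℕ.≤ n
    nonempty-size P-size (x , x∈P) = injection-≤ P-size (λ (_ : Fin 1) → x) (λ { {zero} {zero} _ → refl }) λ _ → x∈P

  -- Balls and connected components

  module _ {V : Set} {Adj : Rel V 0ℓ} where

    Distance≤-mono : ∀ {r r′ x y} → r ℕ.≤ r′ → Distance≤ Adj r x y → Distance≤ Adj r′ x y
    Distance≤-mono r≤r′         here         = here
    Distance≤-mono (ℕ.s≤s r≤r′) (step x~y d) = step x~y (Distance≤-mono r≤r′ d)

    Distance≤-snoc : ∀ {r x y z} → Distance≤ Adj r x y → Adj y z → Distance≤ Adj (suc r) x z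
    Distance≤-snoc here         y~z = step y~z here
    Distance≤-snoc (step x~w d) y~z = step x~w (Distance≤-snoc d y~z)

    Distance≤⇒Component : ∀ {r x y} → Distance≤ Adj r x y → Component Adj x y
    Distance≤⇒Component here         = nil
    Distance≤⇒Component (step x~y d) = x~y ◅ Distance≤⇒Component d

    -- A walk from u never leaves the ball: an edge from one of its nodes leads into the ball of
    -- radius i + 1, which is no larger.
    stable-ball : ∀ {i u} → (∀ v → Distance≤ Adj (suc i) u v → Distance≤ Adj i u v) →
                  ∀ v → Component Adj u v → Distance≤ Adj i u v
    stable-ball {i} {u} stable v = extend here
      where
      extend : ∀ {w v} → Distance≤ Adj i u w → Star Adj w v → Distance≤ Adj i u v
      extend d nil         = d
      extend d (w~x ◅ x~v) = extend (stable _ (Distance≤-snoc d w~x)) x~v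

    -- Each radius contributes a new node: were there none at distance exactly i + 1, the ball of
    -- radius i would be stable and hence the whole component.
    unsaturated-ball : ∀ i {u} → ¬ (∀ v → Component Adj u v → Distance≤ Adj i u v) →
                       Σ[ f ∈ (Fin (suc i) → V) ] Injective _≡_ _≡_ f × (∀ j → Distance≤ Adj i u (f j))
    unsaturated-ball zero    {u} _ = (λ _ → u) , (λ { {zero} {zero} _ → refl }) , λ _ → here
    unsaturated-ball (suc i) {u} ¬sat
      with unsaturated-ball i {u} (λ sat → ¬sat λ v c → Distance≤-mono (ℕ.n≤1+n i) (sat v c))
         | lem {P = ∃[ w ] Distance≤ Adj (suc i) u w × ¬ Distance≤ Adj i u w}
    ... | f , f-inj , f-near | yes (w , near , ¬nearer) = w Vector.∷ f , inj , in-ball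
      where
      w≢f : ∀ j → ¬ w ≡ f j
      w≢f j refl = ¬nearer (f-near j)
      inj : Injective _≡_ _≡_ (w Vector.∷ f)
      inj {zero}  {zero}  _     = refl
      inj {zero}  {suc j} w≡fj  = ⊥-elim (w≢f j w≡fj)
      inj {suc j} {zero}  fj≡w  = ⊥-elim (w≢f j (sym fj≡w))
      inj {suc j} {suc k} fj≡fk = cong suc (f-inj fj≡fk)
      in-ball : ∀ j → Distance≤ Adj (suc i) u ((w Vector.∷ f) j)
      in-ball zero    = near
      in-ball (suc j) = Distance≤-mono (ℕ.n≤1+n i) (f-near j)
    ... | _ | no none = ⊥-elim (¬sat λ v c → Distance≤-mono (ℕ.n≤1+n i) (stable-ball stable v c))
      where
      stable : ∀ v → Distance≤ Adj (suc i) u v → Distance≤ Adj i u v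
      stable v near = by-contradiction λ ¬nearer → none (v , near , ¬nearer)

    -- The r + 1 spheres of radius 0, …, r around u cannot all be nonempty.
    small-ball-saturated : ∀ {Q : Pred V 0ℓ} {r m u} → HasSize Q m → m ℕ.≤ r →
                           (∀ v → Distance≤ Adj r u v → Q v) →
                           ∀ v → Component Adj u v ⇔ Distance≤ Adj r u v
    small-ball-saturated {Q} {r} Q-size m≤r ball⊆Q v =
      mk⇔ (by-contradiction too-many v) Distance≤⇒Component
      where
      too-many : ¬ ¬ (∀ v → Component Adj _ v → Distance≤ Adj r _ v)
      too-many ¬sat = let f , f-inj , f-near = unsaturated-ball r ¬sat in
        ℕ.<⇒≱ (ℕ.s≤s m≤r) (injection-≤ Q-size f f-inj λ j → ball⊆Q _ (f-near j))

    listed-ball : ∀ {D} → DegreesBoundedBy Adj D → ∀ r x → ∃[ l ] (∀ y → Distance≤ Adj r x y → y ∈ˡ l)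
    listed-ball bounded zero    x = x ∷ [] , λ { y here → here refl }
    listed-ball bounded (suc r) x =
      let _ , _ , N-size = bounded x
          N , adj⇒∈N , _ = HasSize-elements N-size
          ball y = proj₁ (listed-ball bounded r y)
      in x ∷ List.concat (List.map ball N) , λ where
        y here         → here refl
        y (step x~z d) → there (∈-concat⁺′ (proj₂ (listed-ball bounded r _) y d) (∈-map⁺ ball (adj⇒∈N _ x~z)))

    ball-size : ∀ {D} → DegreesBoundedBy Adj D → ∀ r x → ∃ (HasSize (Distance≤ Adj r x))
    ball-size bounded r x = let l , ball⊆l = listed-ball bounded r x in listed⇒HasSize l ball⊆l

    ball-type-exists : Symmetric Adj → Irreflexive _≡_ Adj → ∀ {r u n} →
                       HasSize (Distance≤ Adj r u) n →
                       ∃[ S ] RootedGraph.size S ≡ n × BallType Adj r u S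
    ball-type-exists sym-Adj irrefl-Adj {r} {u} {n} ball@(f , f-inj , enum) = S , refl , record
      { embed          = f
      ; enumerates     = f-inj , enum
      ; preserves-adj  = λ i j → mk⇔ (reflect i j) (reify i j)
      ; preserves-root = proj₂ root
      }
      where
      adj : Fin n → Fin n → Bool
      adj i j = does (lem {P = Adj (f i) (f j)})
      root : ∃[ i ] f i ≡ u
      root = to (enum u) here
      S : RootedGraph
      S = record
        { graph = record
          { size       = n
          ; nonempty   = ℕ.>-nonZero (nonempty-size ball (u , here))
          ; adj        = adj
          ; adj-sym    = λ i j → does-⇔ (mk⇔ sym-Adj sym-Adj) lem lem
          ; adj-irrefl = λ i → dec-false lem (irrefl-Adj refl)
          }
        ; root  = proj₁ root
        }
      reflect : ∀ i j → T (adj i j) → Adj (f i) (f j)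
      reflect i j t with lem {P = Adj (f i) (f j)}
      ... | yes a = a
      reify : ∀ i j → Adj (f i) (f j) → T (adj i j)
      reify i j a = subst T (sym (dec-true lem a)) _

    ball-type-size : ∀ {r u S} → BallType Adj r u S → HasSize (Distance≤ Adj r u) (RootedGraph.size S)
    ball-type-size b = BallType.embed b , BallType.enumerates b

    -- Both embeddings enumerate the same ball, so one followed by the inverse of the other is a
    -- rooted isomorphism. This is what makes the indicators of non-isomorphic types disjoint.
    ball-type-unique : ∀ {r u S S′} → BallType Adj r u S → BallType Adj r u S′ → S ≅ S′
    ball-type-unique {r} {u} {S} {S′} b b′ = record
      { bijection      = mk↔ₛ′ (proj₁ ∘ fwd) (proj₁ ∘ bwd)
          (λ j → B′.injective (trans (proj₂ (fwd _)) (proj₂ (bwd j))))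
          (λ i → B.injective (trans (proj₂ (bwd _)) (proj₂ (fwd i))))
      -- `does (T? b)` computes to `b`, so equivalent propositions yield equal Booleans.
      ; preserves-adj  = λ i j → does-⇔ (mk⇔ (fwd-adj i j) (bwd-adj i j)) (T? _) (T? _)
      ; preserves-root = B′.injective (trans (proj₂ (fwd _)) (trans B.preserves-root (sym B′.preserves-root)))
      }
      where
      module S  = RootedGraph S
      module S′ = RootedGraph S′
      module B where
        open BallType b public
        injective = proj₁ enumerates
        enum      = proj₂ enumerates
      module B′ where
        open BallType b′ public
        injective = proj₁ enumerates
        enum      = proj₂ enumerates
      fwd : ∀ i → ∃[ j ] B′.embed j ≡ B.embed i
      fwd i = to (B′.enum _) (from (B.enum _) (i , refl))
      bwd : ∀ j → ∃[ i ] B.embed i ≡ B′.embed j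
      bwd j = to (B.enum _) (from (B′.enum _) (j , refl))
      fwd-adj : ∀ i j → S.Adj i j → S′.Adj (proj₁ (fwd i)) (proj₁ (fwd j))
      fwd-adj i j a = from (B′.preserves-adj _ _)
        (subst₂ Adj (sym (proj₂ (fwd i))) (sym (proj₂ (fwd j))) (to (B.preserves-adj i j) a))
      bwd-adj : ∀ i j → S′.Adj (proj₁ (fwd i)) (proj₁ (fwd j)) → S.Adj i j
      bwd-adj i j a = from (B.preserves-adj i j)
        (subst₂ Adj (proj₂ (fwd i)) (proj₂ (fwd j)) (to (B′.preserves-adj _ _) a))

    ball-type-resp-≅ : ∀ {r u S S′} → S ≅ S′ → BallType Adj r u S → BallType Adj r u S′
    ball-type-resp-≅ {r} {u} {S} {S′} iso b = record
      { embed          = embed ∘ φ⁻¹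
      ; enumerates     = (λ eq → φ⁻¹-injective (proj₁ enumerates eq))
                       , λ x → mk⇔ (λ d → let i , e = to (proj₂ enumerates x) d in
                                      φ i , trans (cong embed (strictlyInverseʳ i)) e)
                                   (λ (j , e) → from (proj₂ enumerates x) (φ⁻¹ j , e))
      ; preserves-adj  = λ i j → subst (λ b → T b ⇔ Adj (embed (φ⁻¹ i)) (embed (φ⁻¹ j)))
          (trans (preserves-adj′ (φ⁻¹ i) (φ⁻¹ j))
                 (cong₂ (RootedGraph.adj S′) (strictlyInverseˡ i) (strictlyInverseˡ j)))
          (preserves-adj (φ⁻¹ i) (φ⁻¹ j))
      ; preserves-root = trans (cong embed (trans (cong φ⁻¹ (sym preserves-root′)) (strictlyInverseʳ _)))
                               preserves-root
      }
      where
      open BallType b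
      open _≅_ iso using (bijection) renaming (preserves-adj to preserves-adj′; preserves-root to preserves-root′)
      open Inverse bijection using (strictlyInverseˡ; strictlyInverseʳ)
      φ   = Inverse.to bijection
      φ⁻¹ = Inverse.from bijection
      φ⁻¹-injective : Injective _≡_ _≡_ φ⁻¹
      φ⁻¹-injective {i} {j} eq = trans (sym (strictlyInverseˡ i)) (trans (cong φ eq) (strictlyInverseˡ j))

  -- Finitely many isomorphism types of bounded size

  ≅-trans : ∀ {S S′ S″} → S ≅ S′ → S′ ≅ S″ → S ≅ S″
  ≅-trans p q = record
    { bijection      = p.bijection ∘↔ q.bijection
    ; preserves-adj  = λ i j → trans (p.preserves-adj i j) (q.preserves-adj _ _)
    ; preserves-root = trans (cong (Inverse.to q.bijection) p.preserves-root) q.preserves-root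
    }
    where
    module p = _≅_ p
    module q = _≅_ q

  ≅-size : ∀ {S S′} → S ≅ S′ → RootedGraph.size S ≡ RootedGraph.size S′
  ≅-size iso = ↔⇒≡ (_≅_.bijection iso)

  -- Symmetrising and deleting loops turns every code into a graph.
  decode : ∀ n → Fin ((2 ^ suc n) ^ suc n) × Fin (suc n) → RootedGraph
  decode n (c , ρ) = record
    { graph = record
      { size       = suc n
      ; nonempty   = _
      ; adj        = λ i j → not (does (i Fin.≟ j)) ∧ (bit i j ∨ bit j i)
      ; adj-sym    = λ i j → cong₂ _∧_ (cong not (does-⇔ (mk⇔ sym sym) (i Fin.≟ j) (j Fin.≟ i))) (∨-comm (bit i j) (bit j i))
      ; adj-irrefl = λ i → cong (λ b → not b ∧ (bit i i ∨ bit i i)) (dec-true (i Fin.≟ i) refl)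
      }
    ; root  = ρ
    }
    where
    bit : Fin (suc n) → Fin (suc n) → Bool
    bit i j = does (finToFun {2} {suc n} (finToFun {2 ^ suc n} {suc n} c i) j Fin.≟ suc zero)

  -- The code of S is its own adjacency matrix, each row packed into a number with binary digits and
  -- the rows packed in turn. Decoding leaves the matrix unchanged, because it is already symmetric
  -- with zero diagonal.
  decode-surjective : ∀ S → ∃[ n ] suc n ≡ RootedGraph.size S × (∃[ c ] S ≅ decode n c)
  decode-surjective S@record { graph = G@record { size = suc n } } =
    n , refl , (funToFin row , S.root) , record
      { bijection      = mk↔ₛ′ (λ i → i) (λ i → i) (λ _ → refl) (λ _ → refl)
      ; preserves-adj  = agree
      ; preserves-root = refl
      }
    where
    module S = RootedGraph S
    row : Fin (suc n) → Fin (2 ^ suc n)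
    row i = funToFin {suc n} {2} λ j → if S.adj i j then suc zero else zero
    module S′ = RootedGraph (decode n (funToFin row , S.root))
    bit≡adj : ∀ i j → does (finToFun {2} {suc n} (finToFun {2 ^ suc n} {suc n} (funToFin row) i) j Fin.≟ suc zero) ≡ S.adj i j
    bit≡adj i j
      rewrite Fin.finToFun-funToFin row i
            | Fin.finToFun-funToFin {suc n} {2} (λ j → if S.adj i j then suc zero else zero) j
      with S.adj i j
    ... | true  = refl
    ... | false = refl
    agree : ∀ i j → S.adj i j ≡ S′.adj i j
    agree i j = trans (off-diagonal i j) (cong (not (does (i Fin.≟ j)) ∧_)
      (trans (sym (∨-idem _)) (cong₂ _∨_ (sym (bit≡adj i j)) (trans (S.adj-sym i j) (sym (bit≡adj j i))))))
      where
      off-diagonal : ∀ i j → S.adj i j ≡ not (does (i Fin.≟ j)) ∧ S.adj i j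
      off-diagonal i j with i Fin.≟ j
      ... | yes refl = S.adj-irrefl i
      ... | no  _    = refl

  graphs≤ : ℕ → List RootedGraph
  graphs≤ zero    = []
  graphs≤ (suc r) = List.map (decode r) (cartesianProduct (allFin _) (allFin _)) ++ graphs≤ r

  graphs≤-complete : ∀ {r} S → RootedGraph.size S ℕ.≤ r → Any (S ≅_) (graphs≤ r)
  graphs≤-complete {r} S size≤r with decode-surjective S
  ... | n , refl , c , S≅c = search r size≤r
    where
    search : ∀ r → suc n ℕ.≤ r → Any (S ≅_) (graphs≤ r)
    search (suc r) n<r with n ℕ.≟ r
    ... | yes refl = Any.++⁺ˡ (Any.map (λ { refl → S≅c })
            (∈-map⁺ (decode n) (∈-cartesianProduct⁺ (∈-allFin (proj₁ c)) (∈-allFin (proj₂ c)))))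
    ... | no  n≢r  = Any.++⁺ʳ (List.map (decode r) _) (search r (ℕ.≤∧≢⇒< (ℕ.≤-pred n<r) n≢r))

  -- `covers` lets every ball with at most r nodes be recognised; `distinct` ensures that it is
  -- recognised only once, so that a sum over the types has a single nonzero term.
  record Representatives (r : ℕ) : Set where
    field
      number   : ℕ
      type     : Fin number → RootedGraph
      distinct : ∀ {i j} → type i ≅ type j → i ≡ j
      covers   : ∀ S → RootedGraph.size S ℕ.≤ r → ∃[ i ] S ≅ type i

  ≅-sym : ∀ {S S′} → S ≅ S′ → S′ ≅ S
  ≅-sym {S} {S′} iso = record
    { bijection      = mk↔ₛ′ (Inverse.from bijection) (Inverse.to bijection) strictlyInverseʳ strictlyInverseˡ
    ; preserves-adj  = λ i j → sym (trans (preserves-adj _ _)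
        (cong₂ (RootedGraph.adj S′) (strictlyInverseˡ i) (strictlyInverseˡ j)))
    ; preserves-root = trans (cong (Inverse.from bijection) (sym preserves-root)) (strictlyInverseʳ _)
    }
    where
    open _≅_ iso
    open Inverse bijection using (strictlyInverseˡ; strictlyInverseʳ)

  -- Greedy selection from the end of the list: an entry is dropped if it is isomorphic to one kept
  -- before.
  distinct-types : (l : List RootedGraph) →
    ∃[ n ] Σ[ t ∈ (Fin n → RootedGraph) ]
      (∀ {i j} → t i ≅ t j → i ≡ j) × (∀ S → Any (S ≅_) l → ∃[ i ] S ≅ t i)
  distinct-types [] = 0 , (λ ()) , (λ { {()} }) , λ _ ()
  distinct-types (S₀ ∷ l) with distinct-types l
  ... | n , t , distinct , covers with lem {P = ∃[ i ] S₀ ≅ t i}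
  ... | yes (i , S₀≅ti) = n , t , distinct , λ where
          S (here S≅S₀) → i , ≅-trans S≅S₀ S₀≅ti
          S (there p)   → covers S p
  ... | no none = suc n , t′ , distinct′ , λ where
          S (here S≅S₀) → zero , S≅S₀
          S (there p)   → let i , S≅ti = covers S p in suc i , S≅ti
    where
    t′ : Fin (suc n) → RootedGraph
    t′ = S₀ Vector.∷ t
    distinct′ : ∀ {i j} → t′ i ≅ t′ j → i ≡ j
    distinct′ {zero}  {zero}  _   = refl
    distinct′ {zero}  {suc j} iso = ⊥-elim (none (j , iso))
    distinct′ {suc i} {zero}  iso = ⊥-elim (none (i , ≅-sym iso))
    distinct′ {suc i} {suc j} iso = cong suc (distinct iso)

  representatives : ∀ r → Representatives r
  representatives r = let n , t , distinct , covers = distinct-types (graphs≤ r) in record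
    { number = n ; type = t ; distinct = distinct
    ; covers = λ S size≤r → covers S (graphs≤-complete S size≤r) }

-- Closure of σ-algebras under countable quantifiers

module SigmaAlgebra (lem : ∀ {ℓ} → ExcludedMiddle ℓ)
                    {X : Set} {𝓑 : Family X} (σ : IsSigmaAlgebra 𝓑) where

  open IsSigmaAlgebra σ public
    renaming (resp-≐ to respects; U∈ to whole∈; ∁∈ to complement∈; ⋃∈ to union∈)
  open Combinatorics lem using (by-contradiction)

  -- Countability is encoded by the one consequence that matters here, closure under unions indexed
  -- by I. In this form it passes to products and vectors without any enumeration of them.
  Countable : Set → Set₁
  Countable I = {A : I → Pred X 0ℓ} → (∀ i → A i ∈ 𝓑) → (λ x → ∃[ i ] A i x) ∈ 𝓑

  ∅∈ : (λ _ → ⊥) ∈ 𝓑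
  ∅∈ = respects ((λ ¬u → ¬u _) , λ ()) (complement∈ whole∈)

  constant∈ : ∀ (P : Set) → (λ _ → P) ∈ 𝓑
  constant∈ P with lem {P = P}
  ... | yes p = respects ((λ _ → p) , λ _ → _) whole∈
  ... | no ¬p = respects ((λ ()) , ¬p) ∅∈

  ∪∈ : ∀ {A B} → A ∈ 𝓑 → B ∈ 𝓑 → (A ∪ B) ∈ 𝓑
  ∪∈ {A} {B} A∈ B∈ = respects (fwd , bwd) (union∈ {A = pair} pair∈)
    where
    pair : ℕ → Pred X 0ℓ
    pair zero    = A
    pair (suc _) = B
    pair∈ : ∀ n → pair n ∈ 𝓑
    pair∈ zero    = A∈
    pair∈ (suc _) = B∈
    fwd : ∀ {x} → ∃[ n ] pair n x → (A ∪ B) x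
    fwd (zero  , a) = inj₁ a
    fwd (suc _ , b) = inj₂ b
    bwd : ∀ {x} → (A ∪ B) x → ∃[ n ] pair n x
    bwd (inj₁ a) = 0 , a
    bwd (inj₂ b) = 1 , b

  ∩∈ : ∀ {A B} → A ∈ 𝓑 → B ∈ 𝓑 → (A ∩ B) ∈ 𝓑
  ∩∈ A∈ B∈ = respects
    ( (λ ¬∪ → by-contradiction (¬∪ ∘ inj₁) , by-contradiction (¬∪ ∘ inj₂))
    , λ { (a , b) (inj₁ ¬a) → ¬a a ; (a , b) (inj₂ ¬b) → ¬b b })
    (complement∈ (∪∈ (complement∈ A∈) (complement∈ B∈)))

  ∀∈ : ∀ {I} → Countable I → {A : I → Pred X 0ℓ} → (∀ i → A i ∈ 𝓑) → (λ x → ∀ i → A i x) ∈ 𝓑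
  ∀∈ countable A∈ = respects
    ((λ ¬∃ i → by-contradiction λ ¬a → ¬∃ (i , ¬a)) , λ all (i , ¬a) → ¬a (all i))
    (complement∈ (countable (complement∈ ∘ A∈)))

  implies∈ : ∀ (P : Set) {A} → A ∈ 𝓑 → (λ x → P → A x) ∈ 𝓑
  implies∈ P A∈ with lem {P = P}
  ... | yes p = respects ((λ a _ → a) , λ f → f p) A∈
  ... | no ¬p = respects ((λ _ → ⊥-elim ∘ ¬p) , _) whole∈

  equivalent∈ : ∀ (P : Set) {A} → A ∈ 𝓑 → (λ x → P ⇔ A x) ∈ 𝓑
  equivalent∈ P A∈ with lem {P = P}
  ... | yes p = respects ((λ a → mk⇔ (λ _ → a) (λ _ → p)) , λ e → to e p) A∈
  ... | no ¬p = respects ((λ ¬a → mk⇔ (⊥-elim ∘ ¬p) (⊥-elim ∘ ¬a)) , λ e a → ¬p (from e a)) (complement∈ A∈)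

  ℕ-countable : Countable ℕ
  ℕ-countable = union∈

  ×-countable : ∀ {I K} → Countable I → Countable K → Countable (I × K)
  ×-countable I-countable K-countable A∈ = respects
    ((λ (i , k , a) → (i , k) , a) , λ ((i , k) , a) → i , k , a)
    (I-countable λ i → K-countable λ k → A∈ (i , k))

  -- Vectors rather than functions on `Fin`: every vector is literally built by `∷`, so no function
  -- extensionality is called for.
  Vec-countable : ∀ {I} n → Countable I → Countable (Vec I n)
  Vec-countable zero    _           A∈ = respects ((λ a → [] , a) , λ { ([] , a) → a }) (A∈ [])
  Vec-countable (suc n) I-countable A∈ = respects
    ((λ (i , v , a) → i ∷ v , a) , λ { (i ∷ v , a) → i , v , a })
    (I-countable λ i → Vec-countable n I-countable λ v → A∈ (i ∷ v))

  Fin-countable : ∀ n → Countable (Fin n)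
  Fin-countable zero    A∈ = respects ((λ ()) , λ { (() , _) }) ∅∈
  Fin-countable (suc n) A∈ = respects
    ((λ { (inj₁ a) → zero , a ; (inj₂ (i , a)) → suc i , a })
    , λ { (zero , a) → inj₁ a ; (suc i , a) → inj₂ (i , a) })
    (∪∈ (A∈ zero) (Fin-countable n (A∈ ∘ suc)))

module TotalRank (lem : ∀ {ℓ} → ExcludedMiddle ℓ) (ℝ : CompleteOrderedField) where

  open CompleteOrderedField ℝ hiding (zero)
  open Classical lem ℝ
  open OrderedField lem ℝ
  open Combinatorics lem

  cardinality-finite : ∀ {X : Set} {P : Pred X 0ℓ} {n} → HasSize P n → cardinality P ≡ just n
  cardinality-finite {P = P} P-size with lem {P = ∃ (HasSize P)}
  ... | yes (_ , P-size′) = ≡.cong just (HasSize-unique P-size′ P-size)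
  ... | no  infinite      = ⊥-elim (infinite (_ , P-size))

  -- Borel measurability of ball types

  module BorelGraph (𝐆 : Graphing) where

    open Graphing 𝐆
    open SigmaAlgebra lem (IsProbability.isSigmaAlgebra isProbability)

    private
      d : J → J → Carrier
      d = proj₁ isStandardBorel
      open IsPolishMetric (proj₁ (proj₂ isStandardBorel)) hiding (complete)
      s : ℕ → J
      s = proj₁ separable

    -- Indices of a countable base of the Polish topology.
    Index : Set
    Index = ℕ × ℕ

    Index-countable : Countable Index
    Index-countable = ×-countable ℕ-countable ℕ-countable

    Near : Index → Pred J 0ℓ
    Near (m , n) y = d (s m) y < fromℕ (suc n) ⁻¹

    Near-open : ∀ i → Open d (Near i)
    Near-open (m , n) x near = radius - d (s m) x , (gap (proj₁ near) , room≉0) , inside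
      where
      radius : Carrier
      radius = fromℕ (suc n) ⁻¹
      room≉0 : ¬ 0# ≈ radius - d (s m) x
      room≉0 0≈ = <⇒≱ near (≤-by ≤-refl (trans
        (solve 2 (λ a b → b :- a := :- (a :- b)) refl radius (d (s m) x))
        (trans (-‿cong (sym 0≈)) (solve 0 (:- :0 := :0) refl))))
      inside : ∀ y → d x y < radius - d (s m) x → Near (m , n) y
      inside y d< = ≤-<-trans (triangle (s m) x y) (≰⇒< λ bad → <⇒≱ d<
        (≤-by (gap bad) (solve 3 (λ a b c → c :- (a :- b) := (b :+ c) :- a) refl radius (d (s m) x) (d x y))))

    Near∈ : ∀ i → Near i ∈ 𝓑
    Near∈ i = proj₂ (proj₂ (proj₂ isStandardBorel)) (base (Near-open i))

    dist-pos : ∀ {x y} → ¬ x ≡ y → 0# < d x y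
    dist-pos {x} {y} x≢y = nonneg x y , λ 0≈d → x≢y (to (zero⇔≡ x y) (sym 0≈d))

    isolating-radius : ∀ y (l : List J) → ∃[ ε ] 0# < ε × (∀ z → z ∈ˡ l → ¬ y ≡ z → ε ≤ d y z)
    isolating-radius y []      = 1# , 0<1 , λ _ ()
    isolating-radius y (a ∷ l) with isolating-radius y l | lem {P = y ≡ a}
    ... | ε , 0<ε , far | yes y≡a = ε , 0<ε , λ where
            z (here ≡.refl) y≢z → ⊥-elim (y≢z y≡a)
            z (there z∈l)   y≢z → far z z∈l y≢z
    ... | ε , 0<ε , far | no y≢a with total (d y a) ε
    ... | inj₁ da≤ε = d y a , dist-pos y≢a , λ where
            z (here ≡.refl) _   → ≤-refl
            z (there z∈l)   y≢z → ≤-trans da≤ε (far z z∈l y≢z)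
    ... | inj₂ ε≤da = ε , 0<ε , λ where
            z (here ≡.refl) _   → ε≤da
            z (there z∈l)   y≢z → far z z∈l y≢z

    isolate : ∀ y (l : List J) → ∃[ i ] Near i y × (∀ z → z ∈ˡ l → Near i z → y ≡ z)
    isolate y l =
      let ε , 0<ε , far = isolating-radius y l
          -- Two points of a ball of radius η may be almost 2η apart, hence half the isolating
          -- radius.
          η , 0<η , η+η≈ε = half 0<ε
          n , n⁻¹≤η = small-reciprocal 0<η
          m , near  = proj₂ separable y (fromℕ (suc n) ⁻¹) (⁻¹-pos (fromℕ-pos n))
      in (m , n) , near , λ z z∈l near′ → by-contradiction λ y≢z →
        <⇒≱ (+-mono-<-≤ near (proj₁ near′))
          (≤-trans (+-mono-≤ n⁻¹≤η n⁻¹≤η) (≤-trans (≤-reflexive η+η≈ε)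
            (≤-trans (far z z∈l y≢z) (≤-trans (triangle y (s m) z)
              (≤-reflexive (+-congʳ (symmetric y (s m))))))))

    separate : ∀ {x y} → ¬ x ≡ y → ∃[ i ] Near i x × ¬ Near i y
    separate {x} {y} x≢y =
      let i , x-near , alone = isolate x (y ∷ []) in i , x-near , λ y-near → x≢y (alone y (here ≡.refl) y-near)

    Touching : Pred J 0ℓ → Pred J 0ℓ
    Touching B x = ∃[ y ] Adj x y × B y

    neighbours-listed : ∀ x → ∃[ l ] (∀ y → Adj x y → y ∈ˡ l) × (∀ y → y ∈ˡ l → Adj x y)
    neighbours-listed x = HasSize-elements (proj₂ (proj₂ (proj₂ E-bounded x)))

    -- This set is a projection of a part of E, so it is not Borel for general reasons; it is Borel
    -- because it is the set where the measurable function `deg B` is at least 1.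
    Touching∈ : ∀ {B} → B ∈ 𝓑 → Touching B ∈ 𝓑
    Touching∈ {B} B∈ = respects (fwd , bwd) (deg-measurable B∈ 1#)
      where
      fwd : ∀ {x} → 1# ≤ deg B x → Touching B x
      fwd {x} 1≤deg with lem {P = ∃ (HasSize (Neighbours Adj x ∩ B))}
      ... | yes (suc n , f , _ , enum) = f zero , from (enum (f zero)) (zero , ≡.refl)
      ... | yes (zero , _) = ⊥-elim (<⇒≱ 0<1 1≤deg)
      ... | no _           = ⊥-elim (<⇒≱ 0<1 1≤deg)
      bwd : ∀ {x} → Touching B x → 1# ≤ deg B x
      bwd {x} touching
        with listed⇒HasSize (proj₁ (neighbours-listed x)) {Neighbours Adj x ∩ B}
               (λ y (x~y , _) → proj₁ (proj₂ (neighbours-listed x)) y x~y)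
      ... | n , sized = ≤-respʳ-≈ (reflexive (≡.cong finiteValue (≡.sym (cardinality-finite sized))))
              (≤-respˡ-≈ (+-identityʳ 1#) (fromℕ-mono (nonempty-size sized touching)))

    Isolated : Index → J → Pred J 0ℓ
    Isolated i x y = Adj x y × Near i y × (∀ z → Adj x z → Near i z → y ≡ z)

    -- Uniqueness is a statement about pairs of points. It becomes countable because two distinct
    -- neighbours in `Near i` are separated by some base set k, so that x touches both
    -- `Near i ∩ Near k` and `Near i ∩ ∁ (Near k)`.
    Isolated∈ : ∀ i → (λ x → ∃ (Isolated i x)) ∈ 𝓑
    Isolated∈ i = respects (fwd , bwd)
      (∩∈ (Touching∈ (Near∈ i)) (complement∈ (Index-countable λ k →
        ∩∈ (Touching∈ (∩∈ (Near∈ i) (Near∈ k))) (Touching∈ (∩∈ (Near∈ i) (complement∈ (Near∈ k)))))))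
      where
      Split : Index → Pred J 0ℓ
      Split k = Touching (Near i ∩ Near k) ∩ Touching (Near i ∩ ∁ (Near k))
      fwd : ∀ {x} → Touching (Near i) x × ¬ (∃[ k ] Split k x) → ∃ (Isolated i x)
      fwd ((y , x~y , near) , ¬split) = y , x~y , near , λ z x~z near′ → by-contradiction λ y≢z →
        let k , y-near , z-far = separate y≢z
        in ¬split (k , (y , x~y , near , y-near) , (z , x~z , near′ , z-far))
      bwd : ∀ {x} → ∃ (Isolated i x) → Touching (Near i) x × ¬ (∃[ k ] Split k x)
      bwd (y , x~y , near , unique) = (y , x~y , near) ,
        λ (k , (v , x~v , v-near , v-in) , (w , x~w , w-near , w-out)) →
          w-out (≡.subst (Near k) (≡.trans (≡.sym (unique v x~v v-near)) (unique w x~w w-near)) v-in)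

    -- Countably many Borel maps whose values at x are exactly x and its
    -- neighbours: the i-th map picks the neighbour isolated by the i-th set of a
    -- countable family separating points from finite sets.
    move : Index → J → J
    move i x with lem {P = ∃ (Isolated i x)}
    ... | yes (y , _) = y
    ... | no  _       = x

    -- Where a neighbour is isolated, it lies in B exactly when x touches `Near i ∩ B`; everywhere
    -- else the map is the identity.
    move-measurable : ∀ i → MeasurableMap 𝓑 𝓑 (move i)
    move-measurable i {B} B∈ = respects ((λ {x} → fwd x) , λ {x} → bwd x)
      (∪∈ (∩∈ (Isolated∈ i) (Touching∈ (∩∈ (Near∈ i) B∈))) (∩∈ (complement∈ (Isolated∈ i)) B∈))
      where
      Cases : Pred J 0ℓ
      Cases = ((λ x → ∃ (Isolated i x)) ∩ Touching (Near i ∩ B)) ∪ (∁ (λ x → ∃ (Isolated i x)) ∩ B)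
      fwd : ∀ x → Cases x → B (move i x)
      fwd x cases with lem {P = ∃ (Isolated i x)} | cases
      ... | yes (y , x~y , near , unique) | inj₁ (_ , z , x~z , near′ , z∈B) =
              ≡.subst B (≡.sym (unique z x~z near′)) z∈B
      ... | yes isolated | inj₂ (none , _)   = ⊥-elim (none isolated)
      ... | no  none     | inj₁ (isolated , _) = ⊥-elim (none isolated)
      ... | no  _        | inj₂ (_ , x∈B)    = x∈B
      bwd : ∀ x → B (move i x) → Cases x
      bwd x in-B with lem {P = ∃ (Isolated i x)}
      ... | yes (y , x~y , near , unique) = inj₁ ((y , x~y , near , unique) , y , x~y , near , in-B)
      ... | no  none = inj₂ (none , in-B)

    move-near : ∀ i x → move i x ≡ x ⊎ Adj x (move i x)
    move-near i x with lem {P = ∃ (Isolated i x)}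
    ... | yes (y , x~y , _) = inj₂ x~y
    ... | no  _             = inj₁ ≡.refl

    isolate-neighbour : ∀ x y → ∃[ i ] Near i y × (∀ z → Adj x z → Near i z → y ≡ z)
    isolate-neighbour x y =
      let N , adj⇒∈N , _   = neighbours-listed x
          i , near , alone = isolate y N
      in i , near , λ z x~z → alone z (adj⇒∈N z x~z)

    move-isolated : ∀ {i x y} → Isolated i x y → move i x ≡ y
    move-isolated {i} {x} {y} isolated@(x~y , near , _) with lem {P = ∃ (Isolated i x)}
    ... | yes (z , _ , _ , unique) = unique y x~y near
    ... | no  none                 = ⊥-elim (none (y , isolated))

    move-onto : ∀ {x y} → Adj x y → ∃[ i ] move i x ≡ y
    move-onto {x} {y} x~y =
      let i , near , alone = isolate-neighbour x y in i , move-isolated (x~y , near , alone)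

    move-stays : ∀ {i x} → (∀ z → Adj x z → ¬ Near i z) → move i x ≡ x
    move-stays {i} {x} far with lem {P = ∃ (Isolated i x)}
    ... | yes (z , x~z , near , _) = ⊥-elim (far z x~z near)
    ... | no  _                    = ≡.refl

    -- A base set around x that misses all neighbours of x isolates none of them, so its map falls
    -- back to the identity at x. Thus walks of exactly r moves can also reach nodes at a smaller
    -- distance.
    move-fixes : ∀ x → ∃[ i ] move i x ≡ x
    move-fixes x =
      let i , _ , alone = isolate-neighbour x x
      in i , move-stays λ z x~z near → E-irrefl (alone z x~z near) x~z

    walk : ∀ {r} → Vec Index r → J → J
    walk []      x = x
    walk (i ∷ w) x = walk w (move i x)

    walk-measurable : ∀ {r} (w : Vec Index r) → MeasurableMap 𝓑 𝓑 (walk w)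
    walk-measurable []      B∈ = B∈
    walk-measurable (i ∷ w) B∈ = move-measurable i (walk-measurable w B∈)

    walk-within : ∀ {r} (w : Vec Index r) x → Distance≤ Adj r x (walk w x)
    walk-within []      x = here
    walk-within (i ∷ w) x with move i x | move-near i x
    ... | _ | inj₁ ≡.refl = Distance≤-mono (ℕ.n≤1+n _) (walk-within w x)
    ... | y | inj₂ x~y    = step x~y (walk-within w y)

    walk-onto : ∀ {r x y} → Distance≤ Adj r x y → ∃[ w ] walk {r} w x ≡ y
    walk-onto {zero}  here = [] , ≡.refl
    walk-onto {suc r} {x} here =
      let i , fixed = move-fixes x
          w , arrives = walk-onto {r} {x} here
      in i ∷ w , ≡.trans (≡.cong (walk w) fixed) arrives
    walk-onto (step x~y d) =
      let i , moved   = move-onto x~y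
          w , arrives = walk-onto d
      in i ∷ w , ≡.trans (≡.cong (walk w) moved) arrives

    -- Base sets separate points in either order, so it suffices that every base set containing g x
    -- also contains h x.
    equal∈ : ∀ {g h} → MeasurableMap 𝓑 𝓑 g → MeasurableMap 𝓑 𝓑 h → (λ x → g x ≡ h x) ∈ 𝓑
    equal∈ {g} {h} g-meas h-meas = respects (fwd , bwd)
      (∀∈ Index-countable λ i → complement∈ (∩∈ (g-meas (Near∈ i)) (complement∈ (h-meas (Near∈ i)))))
      where
      fwd : ∀ {x} → (∀ i → ¬ (Near i (g x) × ¬ Near i (h x))) → g x ≡ h x
      fwd same = by-contradiction λ g≢h → let i , g-near , h-far = separate g≢h in same i (g-near , h-far)
      bwd : ∀ {x} → g x ≡ h x → ∀ i → ¬ (Near i (g x) × ¬ Near i (h x))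
      bwd g≡h i (g-near , h-far) = h-far (≡.subst (Near i) g≡h g-near)

    -- The moves carry a point precisely onto itself and its neighbours, so adjacency means being
    -- distinct and joined by some move.
    adjacent∈ : ∀ {g h} → MeasurableMap 𝓑 𝓑 g → MeasurableMap 𝓑 𝓑 h → (λ x → Adj (g x) (h x)) ∈ 𝓑
    adjacent∈ {g} {h} g-meas h-meas = respects ((λ {x} → fwd x) , λ {x} → bwd x)
      (∩∈ (complement∈ (equal∈ g-meas h-meas))
          (Index-countable λ i → equal∈ {g = move i ∘ g} (g-meas ∘ move-measurable i) h-meas))
      where
      fwd : ∀ x → (¬ g x ≡ h x) × (∃[ i ] move i (g x) ≡ h x) → Adj (g x) (h x)
      fwd x (g≢h , i , moved) with move-near i (g x)
      ... | inj₁ stays = ⊥-elim (g≢h (≡.trans (≡.sym stays) moved))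
      ... | inj₂ g~    = ≡.subst (Adj (g x)) moved g~
      bwd : ∀ x → Adj (g x) (h x) → (¬ g x ≡ h x) × (∃[ i ] move i (g x) ≡ h x)
      bwd x g~h = (λ g≡h → E-irrefl g≡h g~h) , move-onto g~h

    -- An embedding of S is addressed by a vector of walks, one per node, and there are countably
    -- many such vectors. Walks of r moves reach exactly the r-ball, so surjectivity onto the ball
    -- also becomes a condition quantified over walks.
    BallType∈ : ∀ r S → (λ x → BallType Adj r x S) ∈ 𝓑
    BallType∈ r S = respects (fwd , bwd)
      (Vec-countable S.size (Vec-countable r Index-countable) λ φ →
        ∩∈ (Fin² λ i j → implies∈ (¬ i ≡ j) (complement∈ (equal∈ (node-meas φ i) (node-meas φ j))))
        (∩∈ (∀∈ (Vec-countable r Index-countable) λ w →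
               Fin-countable S.size λ i → equal∈ (node-meas φ i) (walk-measurable w))
        (∩∈ (Fin² λ i j → equivalent∈ (S.Adj i j) (adjacent∈ (node-meas φ i) (node-meas φ j)))
            (equal∈ (node-meas φ S.root) (λ B∈ → B∈)))))
      where
      module S = RootedGraph S
      Fin² : {A : Fin S.size → Fin S.size → Pred J 0ℓ} → (∀ i j → A i j ∈ 𝓑) → (λ x → ∀ i j → A i j x) ∈ 𝓑
      Fin² A∈ = ∀∈ (Fin-countable S.size) λ i → ∀∈ (Fin-countable S.size) λ j → A∈ i j
      node : Vec (Vec Index r) S.size → Fin S.size → J → J
      node φ i = walk (lookup φ i)
      node-meas : ∀ φ i → MeasurableMap 𝓑 𝓑 (node φ i)
      node-meas φ i = walk-measurable (lookup φ i)
      Presents : Vec (Vec Index r) S.size → Pred J 0ℓ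
      Presents φ x = (∀ i j → ¬ i ≡ j → ¬ node φ i x ≡ node φ j x)
                   × (∀ w → ∃[ i ] node φ i x ≡ walk w x)
                   × (∀ i j → S.Adj i j ⇔ Adj (node φ i x) (node φ j x))
                   × node φ S.root x ≡ x
      fwd : ∀ {x} → ∃[ φ ] Presents φ x → BallType Adj r x S
      fwd {x} (φ , apart , covers , adj , root) = record
        { embed          = λ i → node φ i x
        ; enumerates     = (λ {i} {j} eq → by-contradiction λ i≢j → apart i j i≢j eq)
                         , λ y → mk⇔ (λ near → let w , arrives = walk-onto near
                                                   i , eq      = covers w
                                               in i , ≡.trans eq arrives)
                                     (λ { (i , ≡.refl) → walk-within (lookup φ i) x })
        ; preserves-adj  = adj
        ; preserves-root = root
        }
      bwd : ∀ {x} → BallType Adj r x S → ∃[ φ ] Presents φ x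
      bwd {x} b = φ
                , (λ i j i≢j eq → i≢j (proj₁ enumerates (≡.trans (≡.sym (φ-embed i)) (≡.trans eq (φ-embed j)))))
                , (λ w → let i , eq = to (proj₂ enumerates _) (walk-within w x) in i , ≡.trans (φ-embed i) eq)
                , (λ i j → ≡.subst₂ (λ y z → S.Adj i j ⇔ Adj y z) (≡.sym (φ-embed i)) (≡.sym (φ-embed j)) (preserves-adj i j))
                , ≡.trans (φ-embed S.root) preserves-root
        where
        open BallType b
        address : ∀ i → ∃[ w ] walk {r} w x ≡ embed i
        address i = walk-onto (from (proj₂ enumerates _) (i , ≡.refl))
        φ : Vec (Vec Index r) S.size
        φ = tabulate (proj₁ ∘ address)
        φ-embed : ∀ i → node φ i x ≡ embed i
        φ-embed i = ≡.trans (≡.cong (λ w → walk w x) (lookup∘tabulate _ i)) (proj₂ (address i))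

  -- Indicator functions

  indicator-∈ : ∀ {X : Set} {A : Pred X 0ℓ} {x} → A x → indicator A x ≈ 1#
  indicator-∈ {A = A} {x} x∈A with lem {P = A x}
  ... | yes _  = refl
  ... | no x∉A = ⊥-elim (x∉A x∈A)

  indicator-∉ : ∀ {X : Set} {A : Pred X 0ℓ} {x} → ¬ A x → indicator A x ≈ 0#
  indicator-∉ {A = A} {x} x∉A with lem {P = A x}
  ... | yes x∈A = ⊥-elim (x∉A x∈A)
  ... | no _    = refl

  indicator-cong : ∀ {X Y : Set} {A : Pred X 0ℓ} {B : Pred Y 0ℓ} {x y} →
                   A x ⇔ B y → indicator A x ≈ indicator B y
  indicator-cong {A = A} {B} {x} {y} A⇔B with lem {P = A x}
  ... | yes x∈A = sym (indicator-∈ {A = B} (to A⇔B x∈A))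
  ... | no  x∉A = sym (indicator-∉ {A = B} (x∉A ∘ from A⇔B))

  indicator-∩ : ∀ {X : Set} (A B : Pred X 0ℓ) x → indicator A x * indicator B x ≈ indicator (A ∩ B) x
  indicator-∩ A B x with lem {P = A x}
  ... | no  x∉A = trans (zeroˡ _) (sym (indicator-∉ {A = A ∩ B} (x∉A ∘ proj₁)))
  ... | yes x∈A = trans (*-identityˡ _) (indicator-cong {A = B} {B = A ∩ B} (mk⇔ (x∈A ,_) proj₂))

  indicator-nonneg : ∀ {X : Set} (A : Pred X 0ℓ) x → 0# ≤ indicator A x
  indicator-nonneg A x with lem {P = A x}
  ... | yes _ = 0≤1
  ... | no  _ = ≤-refl

  -- Means of simple functions and bounds on the integral

  module Integration {X : Set} {𝓑 : Family X} {μ : Pred X 0ℓ → Carrier} (prob : IsProbability 𝓑 μ) where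

    open IsProbability prob
    open SigmaAlgebra lem isSigmaAlgebra public
    open import Relation.Binary.Reasoning.Setoid setoid

    tendsto-shift : ∀ {s l} → Tendsto s l → Tendsto (s ∘ suc) l
    tendsto-shift s→l ε 0<ε with s→l ε 0<ε
    ... | N , close = N , λ n N≤n → close (suc n) (ℕ.m≤n⇒m≤1+n N≤n)

    -- For the constant sequence of empty sets the partial sums converge to c. Shifted by one term
    -- they converge to c + c as well, so c = c + c.
    μ-∅ : μ (λ _ → ⊥) ≈ 0#
    μ-∅ = begin
      c             ≈⟨ solve 1 (λ c → c := (c :+ c) :- c) refl c ⟩
      (c + c) - c   ≈⟨ +-congʳ (tendsto-unique (tendsto-shift sums→c) (tendsto-+ (tendsto-const c) sums→c)) ⟨
      c - c         ≈⟨ -‿inverseʳ c ⟩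
      0#            ∎
      where
      c : Carrier
      c = μ (λ _ → ⊥)
      ⋃∅∈ : ⋃ ℕ (λ _ _ → ⊥) ∈ 𝓑
      ⋃∅∈ = respects ((λ ()) , λ ()) ∅∈
      sums→c : Tendsto (λ n → ∑ {n} (λ _ → c)) c
      sums→c = tendsto-limit (μ-cong ⋃∅∈ ∅∈ ((λ ()) , λ ())) (μ-⋃ (λ _ → ∅∈) λ _ _ _ ())
        where
        tendsto-limit : ∀ {s l m} → l ≈ m → Tendsto s l → Tendsto s m
        tendsto-limit l≈m s→l ε 0<ε with s→l ε 0<ε
        ... | N , close = N , λ n N≤n →
          ≤-<-trans (≤-reflexive (∣∣-cong (+-congˡ (-‿cong (sym l≈m))))) (close n N≤n)

    -- Finite additivity comes from padding with empty sets: from the second partial sum on, the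
    -- sums are constant.
    μ-∪ : ∀ {A B} → A ∈ 𝓑 → B ∈ 𝓑 → (∀ x → A x → ¬ B x) → μ (A ∪ B) ≈ μ A + μ B
    μ-∪ {A} {B} A∈ B∈ disjoint = begin
      μ (A ∪ B)     ≈⟨ μ-cong (∪∈ A∈ B∈) (union∈ part∈) ((λ { (inj₁ a) → 0 , a ; (inj₂ b) → 1 , b }) , unpack) ⟩
      μ (⋃ ℕ part)  ≈⟨ tendsto-unique (tendsto-shift (tendsto-shift (μ-⋃ part∈ apart)))
                                       (tendsto-cong (λ n → sym (sum≈ n)) (tendsto-const (μ A + μ B))) ⟩
      μ A + μ B     ∎
      where
      part : ℕ → Pred X 0ℓ
      part zero          = A
      part (suc zero)    = B
      part (suc (suc _)) = λ _ → ⊥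
      part∈ : ∀ n → part n ∈ 𝓑
      part∈ zero          = A∈
      part∈ (suc zero)    = B∈
      part∈ (suc (suc _)) = ∅∈
      unpack : ∀ {x} → ∃[ n ] part n x → (A ∪ B) x
      unpack (zero , a)     = inj₁ a
      unpack (suc zero , b) = inj₂ b
      apart : ∀ m n x → part m x → part n x → m ≡ n
      apart zero       zero       _ _ _ = ≡.refl
      apart zero       (suc zero) x a b = ⊥-elim (disjoint x a b)
      apart (suc zero) zero       x b a = ⊥-elim (disjoint x a b)
      apart (suc zero) (suc zero) _ _ _ = ≡.refl
      sum≈ : ∀ n → ∑ {suc (suc n)} (λ i → μ (part (toℕ i))) ≈ μ A + μ B
      sum≈ n = +-congˡ (trans (+-congˡ (SparseSums.sum-zero +-commutativeMonoid {n} λ _ → μ-∅)) (+-identityʳ _))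

    μ-split : ∀ {A B} → A ∈ 𝓑 → B ∈ 𝓑 → μ B ≈ μ (A ∩ B) + μ (∁ A ∩ B)
    μ-split {A} {B} A∈ B∈ = trans
      (μ-cong B∈ (∪∈ (∩∈ A∈ B∈) (∩∈ (complement∈ A∈) B∈)) (cases , λ { (inj₁ (_ , b)) → b ; (inj₂ (_ , b)) → b }))
      (μ-∪ (∩∈ A∈ B∈) (∩∈ (complement∈ A∈) B∈) λ { _ (a , _) (¬a , _) → ¬a a })
      where
      cases : ∀ {x} → B x → ((A ∩ B) ∪ (∁ A ∩ B)) x
      cases {x} b with lem {P = A x}
      ... | yes a = inj₁ (a , b)
      ... | no ¬a = inj₂ (¬a , b)

    -- Regions may overlap and coefficients may have either sign, so that adding and scaling simple
    -- functions are mere list operations.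
    record Term : Set₁ where
      constructor term
      field
        coefficient : Carrier
        region      : Pred X 0ℓ
        measurable  : region ∈ 𝓑

    value : List Term → X → Carrier
    value []                x = 0#
    value (term c A _ ∷ ts) x = c * indicator A x + value ts x

    massOn : Pred X 0ℓ → List Term → Carrier
    massOn B []                = 0#
    massOn B (term c A _ ∷ ts) = c * μ (A ∩ B) + massOn B ts

    mass : List Term → Carrier
    mass []                = 0#
    mass (term c A _ ∷ ts) = c * μ A + mass ts

    mass-whole : ∀ ts → massOn U ts ≈ mass ts
    mass-whole []                 = refl
    mass-whole (term c A A∈ ∷ ts) = +-cong (*-congˡ (μ-cong (∩∈ A∈ whole∈) A∈ (proj₁ , (_, tt)))) (mass-whole ts)

    mass-split : ∀ {A B} ts → A ∈ 𝓑 → B ∈ 𝓑 → massOn B ts ≈ massOn (A ∩ B) ts + massOn (∁ A ∩ B) ts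
    mass-split []                 A∈ B∈ = sym (+-identityˡ 0#)
    mass-split {A} {B} (term c C C∈ ∷ ts) A∈ B∈ = begin
      c * μ (C ∩ B) + massOn B ts
        ≈⟨ +-cong (*-congˡ (trans (μ-split A∈ (∩∈ C∈ B∈)) (+-cong
             (μ-cong (∩∈ A∈ (∩∈ C∈ B∈)) (∩∈ C∈ (∩∈ A∈ B∈)) (swap , swap))
             (μ-cong (∩∈ (complement∈ A∈) (∩∈ C∈ B∈)) (∩∈ C∈ (∩∈ (complement∈ A∈) B∈)) (swap , swap)))))
             (mass-split ts A∈ B∈) ⟩
      c * (μ (C ∩ (A ∩ B)) + μ (C ∩ (∁ A ∩ B))) + (massOn (A ∩ B) ts + massOn (∁ A ∩ B) ts)
        ≈⟨ solve 5 (λ c p q u v → c :* (p :+ q) :+ (u :+ v) := (c :* p :+ u) :+ (c :* q :+ v)) refl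
             c (μ (C ∩ (A ∩ B))) (μ (C ∩ (∁ A ∩ B))) (massOn (A ∩ B) ts) (massOn (∁ A ∩ B) ts) ⟩
      (c * μ (C ∩ (A ∩ B)) + massOn (A ∩ B) ts) + (c * μ (C ∩ (∁ A ∩ B)) + massOn (∁ A ∩ B) ts) ∎
      where
      swap : ∀ {P Q R : Set} → P × (Q × R) → Q × (P × R)
      swap (p , q , r) = q , p , r

    -- Positivity has to be shown for arbitrary presentations, with overlapping regions. The
    -- constant c and the set B make the induction work: B is split along the region of the leading
    -- term, whose coefficient is absorbed into c on the inside and vanishes on the outside. At the
    -- end c itself is nonnegative, unless B is empty and has measure 0.
    mass-nonneg : ∀ ts c {B} → B ∈ 𝓑 → (∀ x → B x → 0# ≤ c + value ts x) → 0# ≤ c * μ B + massOn B ts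
    mass-nonneg [] c {B} B∈ nonneg with lem {P = ∃ B}
    ... | yes (x , x∈B) = ≤-respʳ-≈ (sym (+-identityʳ _))
            (*-nonneg (≤-respʳ-≈ (+-identityʳ c) (nonneg x x∈B)) (μ-nonneg B∈))
    ... | no  empty     = ≤-reflexive (sym (trans (+-identityʳ _) (trans (*-congˡ
            (trans (μ-cong B∈ ∅∈ ((λ x∈B → empty (_ , x∈B)) , λ ())) μ-∅)) (zeroʳ c))))
    mass-nonneg (term a A A∈ ∷ ts) c {B} B∈ nonneg = ≤-respʳ-≈ recombine (+-nonneg
      (mass-nonneg ts (c + a) (∩∈ A∈ B∈) λ x (x∈A , x∈B) → ≤-respʳ-≈ (inside x∈A) (nonneg x x∈B))
      (mass-nonneg ts c (∩∈ (complement∈ A∈) B∈) λ x (x∉A , x∈B) → ≤-respʳ-≈ (outside x∉A) (nonneg x x∈B)))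
      where
      inside : ∀ {x} → A x → c + (a * indicator A x + value ts x) ≈ (c + a) + value ts x
      inside {x} x∈A = begin
        c + (a * indicator A x + value ts x)  ≈⟨ +-congˡ (+-congʳ (*-congˡ (indicator-∈ {A = A} x∈A))) ⟩
        c + (a * 1# + value ts x)             ≈⟨ solve 3 (λ c a v → c :+ (a :* :1 :+ v) := (c :+ a) :+ v) refl c a (value ts x) ⟩
        (c + a) + value ts x                  ∎
      outside : ∀ {x} → ¬ A x → c + (a * indicator A x + value ts x) ≈ c + value ts x
      outside {x} x∉A = begin
        c + (a * indicator A x + value ts x)  ≈⟨ +-congˡ (+-congʳ (*-congˡ (indicator-∉ {A = A} x∉A))) ⟩
        c + (a * 0# + value ts x)             ≈⟨ solve 3 (λ c a v → c :+ (a :* :0 :+ v) := c :+ v) refl c a (value ts x) ⟩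
        c + value ts x                        ∎
      recombine : ((c + a) * μ (A ∩ B) + massOn (A ∩ B) ts) + (c * μ (∁ A ∩ B) + massOn (∁ A ∩ B) ts)
                  ≈ c * μ B + (a * μ (A ∩ B) + massOn B ts)
      recombine = begin
        ((c + a) * μ (A ∩ B) + massOn (A ∩ B) ts) + (c * μ (∁ A ∩ B) + massOn (∁ A ∩ B) ts)
          ≈⟨ solve 6 (λ c a p q u v → ((c :+ a) :* p :+ u) :+ (c :* q :+ v) := c :* (p :+ q) :+ (a :* p :+ (u :+ v))) refl
               c a (μ (A ∩ B)) (μ (∁ A ∩ B)) (massOn (A ∩ B) ts) (massOn (∁ A ∩ B) ts) ⟩
        c * (μ (A ∩ B) + μ (∁ A ∩ B)) + (a * μ (A ∩ B) + (massOn (A ∩ B) ts + massOn (∁ A ∩ B) ts))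
          ≈⟨ +-cong (*-congˡ (μ-split A∈ B∈)) (+-congˡ (mass-split ts A∈ B∈)) ⟨
        c * μ B + (a * μ (A ∩ B) + massOn B ts) ∎

    -- F is a simple function, with integral v.
    HasMean : (X → Carrier) → Carrier → Set₁
    HasMean F v = Σ[ ts ∈ List Term ] (∀ x → value ts x ≈ F x) × mass ts ≈ v

    HasMean-resp : ∀ {F G u v} → (∀ x → F x ≈ G x) → u ≈ v → HasMean F u → HasMean G v
    HasMean-resp F≈G u≈v (ts , val , m) = ts , (λ x → trans (val x) (F≈G x)) , trans m u≈v

    HasMean-indicator : ∀ {A} → A ∈ 𝓑 → HasMean (indicator A) (μ A)
    HasMean-indicator {A} A∈ = term 1# A A∈ ∷ []
      , (λ x → trans (+-identityʳ _) (*-identityˡ _)) , trans (+-identityʳ _) (*-identityˡ _)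

    HasMean-+ : ∀ {F G u v} → HasMean F u → HasMean G v → HasMean (λ x → F x + G x) (u + v)
    HasMean-+ (ss , s-val , s-mass) (ts , t-val , t-mass) = ss ++ ts
      , (λ x → trans (value-++ ss x) (+-cong (s-val x) (t-val x))) , trans (mass-++ ss) (+-cong s-mass t-mass)
      where
      value-++ : ∀ ss x → value (ss ++ ts) x ≈ value ss x + value ts x
      value-++ []                x = sym (+-identityˡ _)
      value-++ (term _ _ _ ∷ ss) x = trans (+-congˡ (value-++ ss x)) (sym (+-assoc _ _ _))
      mass-++ : ∀ ss → mass (ss ++ ts) ≈ mass ss + mass ts
      mass-++ []                = sym (+-identityˡ _)
      mass-++ (term _ _ _ ∷ ss) = trans (+-congˡ (mass-++ ss)) (sym (+-assoc _ _ _))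

    HasMean-* : ∀ a {F v} → HasMean F v → HasMean (λ x → a * F x) (a * v)
    HasMean-* a (ts , val , m) = List.map scale ts
      , (λ x → trans (value-scale ts x) (*-congˡ (val x))) , trans (mass-scale ts) (*-congˡ m)
      where
      scale : Term → Term
      scale (term c A A∈) = term (a * c) A A∈
      value-scale : ∀ ts x → value (List.map scale ts) x ≈ a * value ts x
      value-scale []                x = sym (zeroʳ a)
      value-scale (term c A _ ∷ ts) x = trans (+-cong (*-assoc _ _ _) (value-scale ts x)) (sym (distribˡ _ _ _))
      mass-scale : ∀ ts → mass (List.map scale ts) ≈ a * mass ts
      mass-scale []                = sym (zeroʳ a)
      mass-scale (term c A _ ∷ ts) = trans (+-cong (*-assoc _ _ _) (mass-scale ts)) (sym (distribˡ _ _ _))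

    HasMean-const : ∀ c → HasMean (λ _ → c) c
    HasMean-const c = HasMean-resp (λ x → trans (*-congˡ (indicator-∈ {A = U} tt)) (*-identityʳ c))
      (trans (*-congˡ μ-total) (*-identityʳ c)) (HasMean-* c (HasMean-indicator whole∈))

    HasMean-∑ : ∀ {n} {F : Fin n → X → Carrier} {v : Fin n → Carrier} →
                (∀ i → HasMean (F i) (v i)) → HasMean (λ x → ∑ (λ i → F i x)) (∑ v)
    HasMean-∑ {zero}  _     = [] , (λ _ → refl) , refl
    HasMean-∑ {suc n} means = HasMean-+ (means zero) (HasMean-∑ (means ∘ suc))

    HasMean-nonneg : ∀ {F v} → HasMean F v → (∀ x → 0# ≤ F x) → 0# ≤ v
    HasMean-nonneg (ts , val , m) nonneg = ≤-respʳ-≈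
      (trans (+-cong (zeroˡ _) (trans (mass-whole ts) m)) (+-identityˡ _))
      (mass-nonneg ts 0# whole∈ λ x _ → ≤-respʳ-≈ (sym (trans (+-identityˡ _) (val x))) (nonneg x))

    HasMean-mono : ∀ {F G u v} → HasMean F u → HasMean G v → (∀ x → F x ≤ G x) → u ≤ v
    HasMean-mono {F} {G} {u} {v} F-mean G-mean F≤G = ≤-by
      (HasMean-nonneg (HasMean-+ G-mean (HasMean-* (- 1#) F-mean)) λ x → ≤-respʳ-≈ (minus (G x) (F x)) (gap (F≤G x)))
      (minus v u)
      where
      minus : ∀ a b → a - b ≈ a + - 1# * b
      minus a b = solve 2 (λ a b → a :- b := a :+ :- :1 :* b) refl a b

    -- A simple function takes finitely many values, so the preimage of any set of reals is
    -- measurable. The induction splits along the regions and accumulates the value in c.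
    HasMean-preimage∈ : ∀ {F v} → HasMean F v → (Φ : Carrier → Set) → (∀ {a b} → a ≈ b → Φ a → Φ b) →
                        (λ x → Φ (F x)) ∈ 𝓑
    HasMean-preimage∈ {F} (ts , val , _) Φ Φ-resp = respects
      ((λ {x} → Φ-resp (trans (+-identityˡ _) (val x))) , λ {x} → Φ-resp (sym (trans (+-identityˡ _) (val x))))
      (preimage ts 0#)
      where
      preimage : ∀ ts c → (λ x → Φ (c + value ts x)) ∈ 𝓑
      preimage []                 c = constant∈ (Φ (c + 0#))
      preimage (term a A A∈ ∷ ts) c = respects ((λ {x} → fwd x) , λ {x} → bwd x)
        (∪∈ (∩∈ A∈ (preimage ts (c + a * 1#))) (∩∈ (complement∈ A∈) (preimage ts (c + a * 0#))))
        where
        shift : ∀ {x} i → indicator A x ≈ i → c + (a * indicator A x + value ts x) ≈ (c + a * i) + value ts x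
        shift i e = trans (+-congˡ (+-congʳ (*-congˡ e))) (sym (+-assoc _ _ _))
        Cases : Pred X 0ℓ
        Cases = (A ∩ λ x → Φ ((c + a * 1#) + value ts x)) ∪ (∁ A ∩ λ x → Φ ((c + a * 0#) + value ts x))
        fwd : ∀ x → Cases x → Φ (c + (a * indicator A x + value ts x))
        fwd x (inj₁ (x∈A , φ)) = Φ-resp (sym (shift 1# (indicator-∈ {A = A} x∈A))) φ
        fwd x (inj₂ (x∉A , φ)) = Φ-resp (sym (shift 0# (indicator-∉ {A = A} x∉A))) φ
        bwd : ∀ x → Φ (c + (a * indicator A x + value ts x)) → Cases x
        bwd x φ = go (lem {P = A x})
          where
          go : Dec (A x) → Cases x
          go (yes x∈A) = inj₁ (x∈A , Φ-resp (shift 1# (indicator-∈ {A = A} x∈A)) φ)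
          go (no  x∉A) = inj₂ (x∉A , Φ-resp (shift 0# (indicator-∉ {A = A} x∉A)) φ)

    HasMean-combination : ∀ {n} (c : Fin n → Carrier) {A : Fin n → Pred X 0ℓ} → (∀ i → A i ∈ 𝓑) →
                          HasMean (λ x → ∑ (λ i → c i * indicator (A i) x)) (∑ (λ i → c i * μ (A i)))
    HasMean-combination c A∈ = HasMean-∑ λ i → HasMean-* (c i) (HasMean-indicator (A∈ i))

    -- The simple function below f is itself a lower sum, and any other one below f lies below it
    -- plus δ, so monotonicity of means bounds all lower sums by q + δ.
    ∫-bounds : ∀ {n} {c : Fin n → Carrier} {A : Fin n → Pred X 0ℓ} {f : X → Carrier} {δ} →
               (∀ i → 0# ≤ c i) → (∀ i → A i ∈ 𝓑) →
               (∀ x → ∑ (λ i → c i * indicator (A i) x) ≤ f x) →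
               (∀ x → f x ≤ ∑ (λ i → c i * indicator (A i) x) + δ) →
               let q = ∑ (λ i → c i * μ (A i)) in q ≤ ∫ 𝓑 μ f × ∫ 𝓑 μ f ≤ q + δ
    ∫-bounds {n} {c} {A} {f} {δ} 0≤c A∈ below above = bounds
      where
      q : Carrier
      q = ∑ (λ i → c i * μ (A i))
      lower : LowerSum 𝓑 μ f q
      lower = n , c , A , 0≤c , A∈ , below , refl
      upper : IsUpperBound (LowerSum 𝓑 μ f) (q + δ)
      upper (m , b , B , 0≤b , B∈ , b-below , v≈) = ≤-respˡ-≈ (sym v≈)
        (HasMean-mono (HasMean-combination b B∈)
                      (HasMean-+ (HasMean-combination c A∈) (HasMean-const δ))
                      (λ x → ≤-trans (b-below x) (above x)))
      bounds : q ≤ ∫ 𝓑 μ f × ∫ 𝓑 μ f ≤ q + δ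
      bounds with lem {P = ∃ (IsSupremum (LowerSum 𝓑 μ f))}
      ... | yes (v , v-upper , v-least) = v-upper lower , v-least upper
      -- The default value of `∫` is ruled out: the lower sums are inhabited and bounded, so their
      -- supremum exists.
      ... | no none = ⊥-elim (none (complete (LowerSum 𝓑 μ f) (q , lower) (q + δ , upper)))

  -- Second moments of a sample and Chebyshev's inequality

  module Sampling
    {X Ω : Set} {𝓑 : Family X} {μ : Pred X 0ℓ → Carrier} {𝓕 : Family Ω} {P : Pred Ω 0ℓ → Carrier}
    (μ-prob : IsProbability 𝓑 μ) (P-prob : IsProbability 𝓕 P)
    {k : ℕ} {x : Fin k → Ω → X} (sample : IndependentSample 𝓑 μ 𝓕 P x)
    {n : ℕ} (c : Fin n → Carrier) {A : Fin n → Pred X 0ℓ} (A∈ : ∀ a → A a ∈ 𝓑)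
    where

    open IndependentSample sample
    open Integration P-prob
    open import Relation.Binary.Reasoning.Setoid setoid
    private
      module M = Integration μ-prob

    F : X → Carrier
    F y = ∑ (λ a → c a * indicator (A a) y)

    m : Carrier
    m = ∑ (λ a → c a * μ (A a))

    -- The joint law prescribes an event for every sample point; taking the whole space at all
    -- positions other than i and j contributes only factors 1.
    pairwise-law : ∀ {i j B C} → ¬ i ≡ j → B ∈ 𝓑 → C ∈ 𝓑 →
                   P ((x i ⊢ B) ∩ (x j ⊢ C)) ≈ μ B * μ C
    pairwise-law {i} {j} {B} {C} i≢j B∈ C∈ = begin
      P ((x i ⊢ B) ∩ (x j ⊢ C))
        ≈⟨ IsProbability.μ-cong P-prob (∩∈ (measurable i B∈) (measurable j C∈)) (∀∈ (Fin-countable k) event∈)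
             ((λ {ω} (b , c) → all b c) , λ {ω} all → ≡.subst (λ S → S (x i ω)) at-i (all i) , ≡.subst (λ S → S (x j ω)) at-j (all j)) ⟩
      P (⋂ (Fin k) (λ l → x l ⊢ D l))
        ≈⟨ joint D D∈ ⟩
      ∏ (λ l → P (x l ⊢ D l))
        ≈⟨ SparseSums.sum-pair *-commutativeMonoid i j i≢j others ⟩
      P (x i ⊢ D i) * P (x j ⊢ D j)
        ≈⟨ *-cong (law i (D∈ i)) (law j (D∈ j)) ⟩
      μ (D i) * μ (D j)
        ≡⟨ ≡.cong₂ (λ S T → μ S * μ T) at-i at-j ⟩
      μ B * μ C ∎
      where
      choose : ∀ {l} → Dec (i ≡ l) → Dec (j ≡ l) → Pred X 0ℓ
      choose (yes _) _       = B
      choose (no _)  (yes _) = C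
      choose (no _)  (no _)  = U
      D : Fin k → Pred X 0ℓ
      D l = choose (i Fin.≟ l) (j Fin.≟ l)
      at-i : D i ≡ B
      at-i with i Fin.≟ i
      ... | yes _  = ≡.refl
      ... | no i≢i = ⊥-elim (i≢i ≡.refl)
      at-j : D j ≡ C
      at-j with i Fin.≟ j | j Fin.≟ j
      ... | yes i≡j | _      = ⊥-elim (i≢j i≡j)
      ... | no _    | yes _  = ≡.refl
      ... | no _    | no j≢j = ⊥-elim (j≢j ≡.refl)
      D∈ : ∀ l → D l ∈ 𝓑
      D∈ l with i Fin.≟ l | j Fin.≟ l
      ... | yes _ | _     = B∈
      ... | no _  | yes _ = C∈
      ... | no _  | no _  = M.whole∈
      event∈ : ∀ l → (x l ⊢ D l) ∈ 𝓕
      event∈ l = measurable l (D∈ l)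
      all : ∀ {ω} → B (x i ω) → C (x j ω) → ∀ l → D l (x l ω)
      all b c l with i Fin.≟ l | j Fin.≟ l
      ... | yes ≡.refl | _          = b
      ... | no _       | yes ≡.refl = c
      ... | no _       | no _       = tt
      others : ∀ l → ¬ i ≡ l → ¬ j ≡ l → P (x l ⊢ D l) ≈ 1#
      others l i≢l j≢l with i Fin.≟ l | j Fin.≟ l
      ... | yes i≡l | _       = ⊥-elim (i≢l i≡l)
      ... | no _    | yes j≡l = ⊥-elim (j≢l j≡l)
      ... | no _    | no _    = trans (law l M.whole∈) (IsProbability.μ-total μ-prob)

    observe : Fin k → Ω → Carrier
    observe i ω = F (x i ω)

    indicator-pullback : ∀ i a ω → indicator (x i ⊢ A a) ω ≈ indicator (A a) (x i ω)
    indicator-pullback i a ω = indicator-cong {A = x i ⊢ A a} {B = A a} (mk⇔ (λ z → z) (λ z → z))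

    observe-mean : ∀ i → HasMean (observe i) m
    observe-mean i = HasMean-resp
      (λ ω → ∑-cong λ a → *-congˡ (indicator-pullback i a ω))
      (∑-cong λ a → *-congˡ (law i (A∈ a)))
      (HasMean-combination c λ a → measurable i (A∈ a))

    ∑-product : ∀ {p q} (f : Fin p → Carrier) (g : Fin q → Carrier) →
                ∑ (λ a → ∑ (λ b → f a * g b)) ≈ ∑ f * ∑ g
    ∑-product f g = trans (∑-cong λ a → sym (*-distribˡ-sum (f a) g)) (sym (*-distribʳ-sum (∑ g) f))

    correlation : Fin k → Fin k → Carrier
    correlation i j = ∑ (λ a → ∑ (λ b → (c a * c b) * P ((x i ⊢ A a) ∩ (x j ⊢ A b))))

    product-mean : ∀ i j → HasMean (λ ω → observe i ω * observe j ω) (correlation i j)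
    product-mean i j = HasMean-resp expand refl
      (HasMean-∑ λ a → HasMean-∑ λ b → HasMean-* (c a * c b)
        (HasMean-indicator (∩∈ (measurable i (A∈ a)) (measurable j (A∈ b)))))
      where
      expand : ∀ ω → ∑ (λ a → ∑ (λ b → (c a * c b) * indicator ((x i ⊢ A a) ∩ (x j ⊢ A b)) ω))
                     ≈ observe i ω * observe j ω
      expand ω = trans
        (∑-cong λ a → ∑-cong λ b → trans
          (*-congˡ (trans (sym (indicator-∩ (x i ⊢ A a) (x j ⊢ A b) ω))
                          (*-cong (indicator-pullback i a ω) (indicator-pullback j b ω))))
          (solve 4 (λ c d e f → (c :* d) :* (e :* f) := (c :* e) :* (d :* f)) refl _ _ _ _))
        (∑-product (λ a → c a * indicator (A a) (x i ω)) (λ b → c b * indicator (A b) (x j ω)))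

    correlation-distinct : ∀ {i j} → ¬ i ≡ j → correlation i j ≈ m * m
    correlation-distinct i≢j = trans
      (∑-cong λ a → ∑-cong λ b → trans (*-congˡ (pairwise-law i≢j (A∈ a) (A∈ b)))
        (solve 4 (λ c d e f → (c :* d) :* (e :* f) := (c :* e) :* (d :* f)) refl _ _ _ _))
      (∑-product (λ a → c a * μ (A a)) (λ b → c b * μ (A b)))

    module _ (0≤F : ∀ y → 0# ≤ F y) (F≤1 : ∀ y → F y ≤ 1#) where

      correlation-self : ∀ i → correlation i i ≤ 1#
      correlation-self i = HasMean-mono (product-mean i i) (HasMean-const 1#) λ ω →
        ≤-trans (*-monoˡ-≤ (0≤F _) (F≤1 _)) (≤-respˡ-≈ (sym (*-identityʳ _)) (F≤1 _))

      δ : Fin k → Fin k → Carrier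
      δ i j with i Fin.≟ j
      ... | yes _ = 1#
      ... | no  _ = 0#

      -- Off the diagonal independence gives m² exactly; on the diagonal the second moment is at
      -- most 1, and the nonnegative m² is added for uniformity. Summation over i and j then bounds
      -- the variance of the sum by k.
      correlation-≤ : ∀ i j → correlation i j ≤ m * m + δ i j
      correlation-≤ i j with i Fin.≟ j
      ... | yes ≡.refl = ≤-trans (correlation-self i)
              (≤-by (square-nonneg m) (solve 1 (λ m → m :* m :+ :1 :- :1 := m :* m) refl m))
      ... | no i≢j = ≤-reflexive (trans (correlation-distinct i≢j) (sym (+-identityʳ _)))

      ∑δ : ∀ i → ∑ (δ i) ≈ 1#
      ∑δ i = trans (SparseSums.sum-single +-commutativeMonoid i off) on
        where
        off : ∀ j → ¬ i ≡ j → δ i j ≈ 0#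
        off j i≢j with i Fin.≟ j
        ... | yes i≡j = ⊥-elim (i≢j i≡j)
        ... | no _    = refl
        on : δ i i ≈ 1#
        on with i Fin.≟ i
        ... | yes _  = refl
        ... | no i≢i = ⊥-elim (i≢i ≡.refl)

      K : Carrier
      K = fromℕ k

      Y : Ω → Carrier
      Y ω = ∑ (λ i → observe i ω)

      Y-mean : HasMean Y (K * m)
      Y-mean = HasMean-resp (λ _ → refl) (∑-const k m) (HasMean-∑ observe-mean)

      second-moment : Carrier
      second-moment = ∑ (λ i → ∑ (λ j → correlation i j))

      Y²-mean : HasMean (λ ω → Y ω * Y ω) second-moment
      Y²-mean = HasMean-resp (λ ω → ∑-product (λ i → observe i ω) (λ j → observe j ω)) refl
        (HasMean-∑ λ i → HasMean-∑ λ j → product-mean i j)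

      second-moment-≤ : second-moment ≤ K * (K * (m * m) + 1#)
      second-moment-≤ = ≤-respʳ-≈ (∑-const k _) (∑-mono λ i → ≤-respʳ-≈
        (trans (∑-distrib-+ (λ _ → m * m) (δ i)) (+-cong (∑-const k (m * m)) (∑δ i)))
        (∑-mono (correlation-≤ i)))

      -- Stated for the sum rather than the average and multiplied out, so that no inverse appears.
      -- The squared deviation dominates t² times the indicator of `bad`; its mean, computed by
      -- expanding the square, is `second-moment` minus (K m)², which is at most K.
      chebyshev : ∀ {t bad} → 0# ≤ t → bad ∈ 𝓕 →
                  (∀ ω → bad ω → t ≤ Y ω - K * m ⊎ t ≤ K * m - Y ω) → (t * t) * P bad ≤ K
      chebyshev {t} {bad} 0≤t bad∈ deviates = ≤-trans
        (HasMean-mono (HasMean-* (t * t) (HasMean-indicator bad∈))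
          (HasMean-+ (HasMean-+ Y²-mean (HasMean-* (- (K * m + K * m)) Y-mean)) (HasMean-const ((K * m) * (K * m))))
          λ ω → ≤-respʳ-≈ (square (Y ω)) (markov ω))
        (≤-by (gap second-moment-≤)
          (solve 3 (λ K m s → K :- (s :+ :- (K :* m :+ K :* m) :* (K :* m) :+ (K :* m) :* (K :* m))
                              := K :* (K :* (m :* m) :+ :1) :- s) refl K m second-moment))
        where
        square : ∀ y → (y - K * m) * (y - K * m) ≈ y * y + - (K * m + K * m) * y + (K * m) * (K * m)
        square y = solve 2 (λ y M → (y :- M) :* (y :- M) := y :* y :+ :- (M :+ M) :* y :+ M :* M) refl y (K * m)
        squares : ∀ {u} → t ≤ u → t * t ≤ u * u
        squares {u} t≤u = ≤-trans (*-monoˡ-≤ 0≤t t≤u)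
          (≤-respˡ-≈ (*-comm _ _) (*-monoˡ-≤ (≤-trans 0≤t t≤u) t≤u))
        deviation : ∀ ω → bad ω → t * t ≤ (Y ω - K * m) * (Y ω - K * m)
        deviation ω ω∈bad with deviates ω ω∈bad
        ... | inj₁ t≤ = squares t≤
        ... | inj₂ t≤ = ≤-respʳ-≈ (solve 2 (λ y M → (M :- y) :* (M :- y) := (y :- M) :* (y :- M)) refl (Y ω) (K * m)) (squares t≤)
        markov : ∀ ω → (t * t) * indicator bad ω ≤ (Y ω - K * m) * (Y ω - K * m)
        markov ω with lem {P = bad ω}
        ... | yes ω∈bad = ≤-respˡ-≈ (sym (*-identityʳ _)) (deviation ω ω∈bad)
        ... | no _      = ≤-respˡ-≈ (sym (zeroʳ _)) (square-nonneg _)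

  -- The truncated reciprocal of the component size

  truncated-reciprocal : ℕ → ℕ → Carrier
  truncated-reciprocal r n with n ℕ.≤? r
  ... | yes _ = fromℕ n ⁻¹
  ... | no  _ = 0#

  truncated-≤ : ∀ {r n} → n ℕ.≤ r → truncated-reciprocal r n ≈ fromℕ n ⁻¹
  truncated-≤ {r} {n} n≤r with n ℕ.≤? r
  ... | yes _  = refl
  ... | no n≰r = ⊥-elim (n≰r n≤r)

  truncated-≰ : ∀ {r n} → ¬ n ℕ.≤ r → truncated-reciprocal r n ≈ 0#
  truncated-≰ {r} {n} n≰r with n ℕ.≤? r
  ... | yes n≤r = ⊥-elim (n≰r n≤r)
  ... | no _    = refl

  fromℕ-positive : ∀ {n} → 1 ℕ.≤ n → 0# < fromℕ n
  fromℕ-positive {suc n} _ = fromℕ-pos n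

  truncated-nonneg : ∀ r S → 0# ≤ truncated-reciprocal r (RootedGraph.size S)
  truncated-nonneg r S with RootedGraph.size S ℕ.≤? r
  ... | yes _ = ⁻¹-nonneg (fromℕ-positive (ℕ.>-nonZero⁻¹ _ {{RootedGraph.nonempty S}}))
  ... | no  _ = ≤-refl

  module Truncation (r : ℕ) where

    open Representatives (representatives r)

    weight : Fin number → Carrier
    weight i = truncated-reciprocal r (RootedGraph.size (type i))

    weight-nonneg : ∀ i → 0# ≤ weight i
    weight-nonneg i = truncated-nonneg r (type i)

    error : Carrier
    error = fromℕ (suc r) ⁻¹

    module _ {V : Set} (Adj : Rel V 0ℓ) where

      HasType : Fin number → Pred V 0ℓ
      HasType i u = BallType Adj r u (type i)

      inverseSize : V → Carrier
      inverseSize u = reciprocal (cardinality (Component Adj u))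

      truncation : V → Carrier
      truncation u = ∑ (λ i → weight i * indicator (HasType i) u)

      truncation-nonneg : ∀ u → 0# ≤ truncation u
      truncation-nonneg u = ∑-nonneg λ i → *-nonneg (weight-nonneg i) (indicator-nonneg (HasType i) u)

      -- Exactly one representative is isomorphic to the ball, and all other terms of the sum
      -- vanish.
      truncation-small : ∀ {u S} → BallType Adj r u S → RootedGraph.size S ℕ.≤ r →
                         truncation u ≈ fromℕ (RootedGraph.size S) ⁻¹
      truncation-small {u} {S} ball size≤r =
        let i , S≅i = covers S size≤r in trans
          (SparseSums.sum-single +-commutativeMonoid i λ j i≢j →
            trans (*-congˡ (indicator-∉ {A = HasType j} λ ball-j →
                     i≢j (distinct (ball-type-unique (ball-type-resp-≅ S≅i ball) ball-j))))
                  (zeroʳ _))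
          (trans (*-congˡ (indicator-∈ {A = HasType i} (ball-type-resp-≅ S≅i ball)))
          (trans (*-identityʳ _)
          (trans (reflexive (≡.cong (truncated-reciprocal r) (≡.sym (≅-size S≅i))))
                 (truncated-≤ size≤r))))

      truncation-large : ∀ {u} → (∀ S → BallType Adj r u S → ¬ RootedGraph.size S ℕ.≤ r) → truncation u ≈ 0#
      truncation-large {u} large = SparseSums.sum-zero +-commutativeMonoid term≈0
        where
        term≈0 : ∀ i → weight i * indicator (HasType i) u ≈ 0#
        term≈0 i with lem {P = HasType i u}
        ... | yes ball = trans (*-congʳ (truncated-≰ (large (type i) ball))) (zeroˡ _)
        ... | no  _    = zeroʳ _

      -- The link to the estimator: the truncation at a sampled node can be computed from any graph
      -- presenting its ball, through the number of nodes alone.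
      truncation-type : ∀ {u S} → BallType Adj r u S → truncation u ≈ truncated-reciprocal r (RootedGraph.size S)
      truncation-type {u} {S} ball with RootedGraph.size S ℕ.≤? r
      ... | yes size≤r = truncation-small ball size≤r
      ... | no  size≰r = truncation-large λ S′ ball′ size′≤r →
              size≰r (≡.subst (ℕ._≤ r) (≅-size (ball-type-unique ball′ ball)) size′≤r)

      inverseSize-≤1 : ∀ u → inverseSize u ≤ 1#
      inverseSize-≤1 u with lem {P = ∃ (HasSize (Component Adj u))}
      ... | no _ = 0≤1
      ... | yes (n , sized) = ≤-respʳ-≈ 1⁻¹≈1 (⁻¹-anti-≤ 0<1 (≤-respˡ-≈ (+-identityʳ 1#)
              (fromℕ-mono (nonempty-size sized (u , nil)))))
        where
        1⁻¹≈1 : 1# ⁻¹ ≈ 1#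
        1⁻¹≈1 = trans (sym (*-identityˡ _)) (⁻¹-inverse-pos 0<1)

      error-nonneg : 0# ≤ error
      error-nonneg = ⁻¹-nonneg (fromℕ-pos r)

      truncation-bounds : Symmetric Adj → Irreflexive _≡_ Adj → ∀ u →
                          truncation u ≤ inverseSize u × inverseSize u ≤ truncation u + error
      truncation-bounds sym-Adj irrefl-Adj u = cases lem
        where
        Small : Set
        Small = ∃[ n ] n ℕ.≤ r × HasSize (Component Adj u) n
        exact : Small → truncation u ≈ inverseSize u
        exact (n , n≤r , sized) =
          -- The component is known to be small here, and it contains the ball.
          let saturated = small-ball-saturated sized n≤r (λ _ → Distance≤⇒Component)
              S , size≡n , ball = ball-type-exists sym-Adj irrefl-Adj (HasSize-resp saturated sized)
          in trans (truncation-small ball (≡.subst (ℕ._≤ r) (≡.sym size≡n) n≤r))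
             (reflexive (≡.trans (≡.cong (λ m → fromℕ m ⁻¹) size≡n)
               (≡.cong reciprocal (≡.sym (cardinality-finite sized)))))
        small : ∀ S → BallType Adj r u S → RootedGraph.size S ℕ.≤ r → Small
        small S ball size≤r = _ , size≤r , HasSize-resp
          -- Here only the ball is known to be small; it bounds itself, and the smallness of the
          -- component follows.
          (λ v → let e = small-ball-saturated (ball-type-size ball) size≤r (λ _ d → d) v in mk⇔ (from e) (to e))
          (ball-type-size ball)
        inverseSize-large : ¬ Small → 0# ≤ inverseSize u × inverseSize u ≤ error
        inverseSize-large ¬small with lem {P = ∃ (HasSize (Component Adj u))}
        ... | no _ = ≤-refl , error-nonneg
        ... | yes (n , sized) = ⁻¹-nonneg (fromℕ-positive (nonempty-size sized (u , nil)))
                              , ⁻¹-anti-≤ (fromℕ-pos r) (fromℕ-mono (ℕ.≰⇒> λ n≤r → ¬small (n , n≤r , sized)))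
        cases : Dec Small → truncation u ≤ inverseSize u × inverseSize u ≤ truncation u + error
        cases (yes s) = ≤-reflexive (exact s)
                      , ≤-respˡ-≈ (trans (+-identityʳ _) (exact s)) (+-monoʳ-≤ (truncation u) error-nonneg)
        cases (no ¬s) =
          let truncation≈0  = truncation-large λ S ball size≤r → ¬s (small S ball size≤r)
              lower , upper = inverseSize-large ¬s
          in ≤-respˡ-≈ (sym truncation≈0) lower
           , ≤-respʳ-≈ (trans (sym (+-identityˡ _)) (+-congʳ (sym truncation≈0))) upper

  radius : ∀ {η} → 0# < η → ∃[ r ] 1 ℕ.≤ r × fromℕ (suc r) ⁻¹ ≤ η
  radius 0<η = let n , n⁻¹≤η = small-reciprocal 0<η in
    -- The successor makes the radius at least 1 even if n is 0; the reciprocal only decreases.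
    suc n , ℕ.s≤s ℕ.z≤n , ≤-trans (⁻¹-anti-≤ (fromℕ-pos n) (fromℕ-mono (ℕ.n≤1+n (suc n)))) n⁻¹≤η

  module _ (𝐆 : Graphing) (r : ℕ) where
    open Graphing 𝐆
    open Truncation r
    open Representatives (representatives r) using (type)

    truncatedMean : Carrier
    truncatedMean = ∑ (λ i → weight i * λ′ (HasType Adj i))

    HasType∈ : ∀ i → HasType Adj i ∈ 𝓑
    HasType∈ i = BorelGraph.BallType∈ 𝐆 r (type i)

    ∫-inverseSize-bounds : truncatedMean ≤ ∫ 𝓑 λ′ (inverseSize Adj)
                         × ∫ 𝓑 λ′ (inverseSize Adj) ≤ truncatedMean + error
    ∫-inverseSize-bounds = Integration.∫-bounds isProbability weight-nonneg HasType∈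
      (proj₁ ∘ truncation-bounds Adj E-sym E-irrefl) (proj₂ ∘ truncation-bounds Adj E-sym E-irrefl)

  -- Finite graphs with the uniform distribution

  module _ (G : FiniteGraph) where
    open FiniteGraph G
    open import Relation.Binary.Reasoning.Setoid setoid

    size-pos : 0# < fromℕ size
    size-pos = fromℕ-positive (ℕ.>-nonZero⁻¹ size {{nonempty}})

    uniformMean-mono : ∀ {f g : Fin size → Carrier} → (∀ u → f u ≤ g u) → uniformMean G f ≤ uniformMean G g
    uniformMean-mono f≤g = *-monoˡ-≤ (⁻¹-nonneg size-pos) (∑-mono f≤g)

    uniformMean-+-const : ∀ (f : Fin size → Carrier) c → uniformMean G (λ u → f u + c) ≈ uniformMean G f + c
    uniformMean-+-const f c = begin
      fromℕ size ⁻¹ * ∑ (λ u → f u + c)            ≈⟨ *-congˡ (trans (∑-distrib-+ f (λ _ → c)) (+-congˡ (∑-const size c))) ⟩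
      fromℕ size ⁻¹ * (∑ f + fromℕ size * c)       ≈⟨ solve 4 (λ i s n c → i :* (s :+ n :* c) := i :* s :+ (n :* i) :* c) refl
                                                        (fromℕ size ⁻¹) (∑ f) (fromℕ size) c ⟩
      fromℕ size ⁻¹ * ∑ f + (fromℕ size * fromℕ size ⁻¹) * c
                                                   ≈⟨ +-congˡ (trans (*-congʳ (⁻¹-inverse-pos size-pos)) (*-identityˡ c)) ⟩
      fromℕ size ⁻¹ * ∑ f + c                      ∎

    uniformMean-combination : ∀ {n} (c : Fin n → Carrier) (A : Fin n → Pred (Fin size) 0ℓ) →
      uniformMean G (λ u → ∑ (λ i → c i * indicator (A i) u)) ≈ ∑ (λ i → c i * uniformProb G (A i))
    uniformMean-combination {n} c A = begin
      s * ∑ (λ u → ∑ (λ i → c i * indicator (A i) u))     ≈⟨ *-congˡ (∑-comm {size} {n} (λ u i → c i * indicator (A i) u)) ⟩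
      s * ∑ (λ i → ∑ (λ u → c i * indicator (A i) u))     ≈⟨ *-congˡ (∑-cong {n} λ i → sym (*-distribˡ-sum (c i) (indicator (A i)))) ⟩
      s * ∑ (λ i → c i * ∑ (indicator (A i)))             ≈⟨ *-distribˡ-sum s (λ i → c i * ∑ (indicator (A i))) ⟩
      ∑ (λ i → s * (c i * ∑ (indicator (A i))))           ≈⟨ ∑-cong {n} (λ i → solve 3 (λ s c t → s :* (c :* t) := c :* (s :* t)) refl s (c i) (∑ (indicator (A i)))) ⟩
      ∑ (λ i → c i * uniformProb G (A i))                 ∎
      where
      s : Carrier
      s = fromℕ size ⁻¹

    module _ (r : ℕ) where
      open Truncation r

      truncatedUniformMean : Carrier
      truncatedUniformMean = ∑ (λ i → weight i * uniformProb G (HasType Adj i))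

      Adj-sym : Symmetric Adj
      Adj-sym {i} {j} = ≡.subst T (adj-sym i j)

      Adj-irrefl : Irreflexive _≡_ Adj
      Adj-irrefl {i} ≡.refl a = ≡.subst T (adj-irrefl i) a

      uniformMean-inverseSize-bounds : truncatedUniformMean ≤ uniformMean G (inverseSize Adj)
                                     × uniformMean G (inverseSize Adj) ≤ truncatedUniformMean + error
      uniformMean-inverseSize-bounds =
          ≤-respˡ-≈ (uniformMean-combination weight (HasType Adj))
            (uniformMean-mono (proj₁ ∘ truncation-bounds Adj Adj-sym Adj-irrefl))
        , ≤-respʳ-≈ (trans (uniformMean-+-const (truncation Adj) error) (+-congʳ (uniformMean-combination weight (HasType Adj))))
            (uniformMean-mono (proj₂ ∘ truncation-bounds Adj Adj-sym Adj-irrefl))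

  -- Convergence along locally convergent sequences

  totalRank-continuous : (G : ℕ → FiniteGraph) (𝐆 : Graphing) → LocallyConverges G 𝐆 →
                         Tendsto (λ n → finiteTotalRank (G n)) (totalRank 𝐆)
  totalRank-continuous G 𝐆 G→𝐆 ε 0<ε =
    -- One half of ε is spent on the truncation error, the other on the distance between the
    -- truncated means.
    let η , 0<η , η+η≈ε    = half 0<ε
        r , 1≤r , error≤η  = radius 0<η
        N , close = convergence r 1≤r η 0<η
    in N , λ n N≤n →
      let lower , upper   = ∫-inverseSize-bounds 𝐆 r
          lowerₙ , upperₙ = uniformMean-inverseSize-bounds (G n) r
          below , above   = between (close n N≤n)
      in ∣∣-< _
           (estimate {truncatedUniformMean (G n) r} {truncatedMean 𝐆 r} upper lowerₙ error≤η above η+η≈ε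
             (solve 4 (λ a b q p → :- (q :- p) := p :- q) refl (mean n) I (truncatedUniformMean (G n) r) (truncatedMean 𝐆 r))
             (solve 2 (λ a b → (:1 :- a) :- (:1 :- b) := b :- a) refl (mean n) I))
           (estimate {truncatedMean 𝐆 r} {truncatedUniformMean (G n) r} upperₙ lower error≤η below η+η≈ε refl
             (solve 2 (λ a b → :- ((:1 :- a) :- (:1 :- b)) := a :- b) refl (mean n) I))
    where
    open Graphing 𝐆 using (Adj; 𝓑; λ′)
    I : Carrier
    I = ∫ 𝓑 λ′ (λ u → reciprocal (cardinality (Component Adj u)))
    mean : ℕ → Carrier
    mean n = uniformMean (G n) (λ u → reciprocal (cardinality (Component (FiniteGraph.Adj (G n)) u)))
    convergence : ∀ r → 1 ℕ.≤ r → Tendsto (λ n → truncatedUniformMean (G n) r) (truncatedMean 𝐆 r)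
    convergence r 1≤r = tendsto-∑ λ i → tendsto-* (weight i) (weight-nonneg i) (G→𝐆 r 1≤r (type i))
      where open Truncation r
            open Representatives (representatives r) using (type)
    -- Truncation errs to one side only: b exceeds q by at most e, while a is not below p. Hence b -
    -- a exceeds q - p by a single e, and the two directions of the convergence differ only in the
    -- roles of graph and graphing.
    estimate : ∀ {p q a b e η x y ε} → b ≤ q + e → p ≤ a → e ≤ η → x < η → η + η ≈ ε →
               x ≈ q - p → y ≈ b - a → y < ε
    estimate {p} {q} {a} {b} {e} {η} {x} {y} b≤ p≤a e≤η x<η η+η≈ε x≈ y≈ =
      ≤-<-trans (≤-respˡ-≈ (sym y≈) (≤-by (+-nonneg (gap b≤) (+-nonneg (gap p≤a) (gap e≤η)))
        (trans (+-congʳ (+-congʳ x≈))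
          (solve 6 (λ p q a b e η → ((q :- p) :+ η) :- (b :- a) := (q :+ e :- b) :+ ((a :- p) :+ (η :- e))) refl p q a b e η))))
      (<-≤-trans (+-mono-<-≤ x<η ≤-refl) (≤-reflexive η+η≈ε))

  -- Local estimability

  totalRank-estimable : LocallyEstimable totalRank
  totalRank-estimable ε 0<ε D = k , r , ℕ.s≤s ℕ.z≤n , 1≤r , estimate , estimate-cong , correct
    where
    open import Relation.Binary.Reasoning.Setoid setoid
    halving = half 0<ε
    η : Carrier
    η = proj₁ halving
    0<η : 0# < η
    0<η = proj₁ (proj₂ halving)
    η+η≈ε : η + η ≈ ε
    η+η≈ε = proj₂ (proj₂ halving)
    choice = radius 0<η
    r : ℕ
    r = proj₁ choice
    1≤r : 1 ℕ.≤ r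
    1≤r = proj₁ (proj₂ choice)
    open Truncation r
    error≤η : error ≤ η
    error≤η = proj₂ (proj₂ choice)
    -- Chebyshev will yield a failure probability of at most 1/(kη²), which is at most ε once kη²ε ≥
    -- 1; so k is chosen above 1/θ.
    θ : Carrier
    θ = (η * η) * ε
    0<θ : 0# < θ
    0<θ = *-pos (*-pos 0<η 0<η) 0<ε
    many = archimedean (θ ⁻¹)
    k : ℕ
    k = suc (proj₁ many)
    K : Carrier
    K = fromℕ k
    0<K : 0# < K
    0<K = fromℕ-pos (proj₁ many)
    1≤Kθ : 1# ≤ K * θ
    1≤Kθ = ≤-respˡ-≈ (⁻¹-inverse-pos 0<θ) (≤-respʳ-≈ (*-comm θ K)
      (*-monoˡ-≤ (proj₁ 0<θ) (≤-trans (proj₂ many) (fromℕ-mono (ℕ.n≤1+n (proj₁ many))))))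
    weightSum : (Fin k → RootedGraph) → Carrier
    weightSum S = ∑ (λ i → truncated-reciprocal r (RootedGraph.size (S i)))
    estimate : (Fin k → RootedGraph) → Carrier
    estimate S = 1# - K ⁻¹ * weightSum S
    estimate-cong : ∀ S S′ → (∀ i → S i ≅ S′ i) → estimate S ≈ estimate S′
    estimate-cong S S′ S≅S′ = +-congˡ (-‿cong (*-congˡ (∑-cong {k} λ i →
      reflexive (≡.cong (truncated-reciprocal r) (≅-size (S≅S′ i))))))

    module _ (𝐆 : Graphing) (bounded : DegreesBoundedBy (Graphing.Adj 𝐆) D)
             {Ω : Set} {𝓕 : Family Ω} {P : Pred Ω 0ℓ → Carrier} (P-prob : IsProbability 𝓕 P)
             {x : Fin k → Ω → Graphing.J 𝐆} (sample : IndependentSample (Graphing.𝓑 𝐆) (Graphing.λ′ 𝐆) 𝓕 P x)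
             where
      open Graphing 𝐆
      module S = Sampling isProbability P-prob sample weight (HasType∈ 𝐆 r)

      I m : Carrier
      I = ∫ 𝓑 λ′ (inverseSize Adj)
      m = truncatedMean 𝐆 r

      F≤1 : ∀ y → S.F y ≤ 1#
      F≤1 y = ≤-trans (proj₁ (truncation-bounds Adj E-sym E-irrefl y)) (inverseSize-≤1 Adj y)

      Y : Ω → Carrier
      Y = S.Y (truncation-nonneg Adj) F≤1

      -- All graphs presenting the sampled balls give the same estimate, so the bad event depends on
      -- the number Y ω alone. Being a preimage under the simple function Y, it is measurable.
      Far : Carrier → Set
      Far y = ε ≤ ∣ (1# - K ⁻¹ * y) - totalRank 𝐆 ∣

      Far-resp : ∀ {a b} → a ≈ b → Far a → Far b
      Far-resp a≈b = ≤-respʳ-≈ (∣∣-cong (+-congʳ (+-congˡ (-‿cong (*-congˡ a≈b)))))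

      bad : Pred Ω 0ℓ
      bad ω = Σ[ S ∈ (Fin k → RootedGraph) ]
                (∀ i → BallType Adj r (x i ω) (S i)) × ε ≤ ∣ estimate S - totalRank 𝐆 ∣

      Y-weightSum : ∀ {ω S} → (∀ i → BallType Adj r (x i ω) (S i)) → Y ω ≈ weightSum S
      Y-weightSum balls = ∑-cong {k} λ i → truncation-type Adj (balls i)

      bad⇒Far : ∀ {ω} → bad ω → Far (Y ω)
      bad⇒Far (S , balls , far) = Far-resp (sym (Y-weightSum balls)) far

      -- The degree bound enters here: it makes the sampled balls finite, so that they are presented
      -- by some finite rooted graphs.
      Far⇒bad : ∀ {ω} → Far (Y ω) → bad ω
      Far⇒bad {ω} far = (λ i → proj₁ (ball i)) , (λ i → proj₂ (proj₂ (ball i)))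
                      , Far-resp (Y-weightSum (λ i → proj₂ (proj₂ (ball i)))) far
        where
        ball : ∀ i → ∃[ S ] RootedGraph.size S ≡ _ × BallType Adj r (x i ω) S
        ball i = ball-type-exists E-sym E-irrefl (proj₂ (ball-size bounded r (x i ω)))

      bad∈ : bad ∈ 𝓕
      bad∈ = Integration.respects P-prob (Far⇒bad , bad⇒Far)
        (Integration.HasMean-preimage∈ P-prob (S.Y-mean (truncation-nonneg Adj) F≤1) Far Far-resp)

      average : ∀ y → K * (K ⁻¹ * y) ≈ y
      average y = trans (sym (*-assoc _ _ _)) (trans (*-congʳ (⁻¹-inverse-pos 0<K)) (*-identityˡ y))

      -- An estimate off by ε leaves the sample average at least η away from the truncated mean m,
      -- because m differs from the integral by at most η. Multiplication by K turns averages into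
      -- sums.
      deviates : ∀ ω → bad ω → K * η ≤ Y ω - K * m ⊎ K * η ≤ K * m - Y ω
      deviates ω ω∈bad with ≤∣∣-cases _ (bad⇒Far ω∈bad)
      ... | inj₁ ε≤ = inj₂ (≤-respʳ-≈ (trans
              (solve 3 (λ K m a → K :* (m :- a) := K :* m :- K :* a) refl K m a) (+-congˡ (-‿cong (average (Y ω)))))
              (*-monoˡ-≤ (proj₁ 0<K) (≤-by
                (+-nonneg (gap ε≤) (+-nonneg (gap (proj₂ (∫-inverseSize-bounds 𝐆 r))) (gap error≤η)))
                (begin
                  (m - a) - η  ≈⟨ solve 6 (λ m a η I δ ε → (m :- a) :- η :=
                                    ((((:1 :- a) :- (:1 :- I)) :- (η :+ η)) :+ ((m :+ δ :- I) :+ (η :- δ)))) refl m a η I error ε ⟩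
                  (((1# - a) - (1# - I)) - (η + η)) + ((m + error - I) + (η - error))
                               ≈⟨ +-congʳ (+-congˡ (-‿cong η+η≈ε)) ⟩
                  (((1# - a) - (1# - I)) - ε) + ((m + error - I) + (η - error)) ∎))))
        where
        a : Carrier
        a = K ⁻¹ * Y ω
      -- In this direction m ≤ I already helps, so the average exceeds m by all of ε = η + η, and
      -- one η is given away.
      ... | inj₂ ε≤ = inj₁ (≤-respʳ-≈ (trans
              (solve 3 (λ K m a → K :* (a :- m) := K :* a :- K :* m) refl K m a) (+-congʳ (average (Y ω))))
              (*-monoˡ-≤ (proj₁ 0<K) (≤-by
                (+-nonneg (gap ε≤) (+-nonneg (gap (proj₁ (∫-inverseSize-bounds 𝐆 r))) (proj₁ 0<η)))
                (begin
                  (a - m) - η  ≈⟨ solve 4 (λ m a η I → (a :- m) :- η :=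
                                    ((:- ((:1 :- a) :- (:1 :- I)) :- (η :+ η)) :+ ((I :- m) :+ η))) refl m a η I ⟩
                  (- ((1# - a) - (1# - I)) - (η + η)) + ((I - m) + η)
                               ≈⟨ +-congʳ (+-congˡ (-‿cong η+η≈ε)) ⟩
                  (- ((1# - a) - (1# - I)) - ε) + ((I - m) + η) ∎))))
        where
        a : Carrier
        a = K ⁻¹ * Y ω

      P-bad : P bad ≤ ε
      -- From (Kη)² P(bad) ≤ K one factor K is cancelled, giving Kη² P(bad) ≤ 1 ≤ Kη²ε; then Kη² is
      -- cancelled.
      P-bad = *-cancelˡ-≤ (*-pos 0<K (*-pos 0<η 0<η)) (≤-trans
        (*-cancelˡ-≤ 0<K (≤-respˡ-≈
          (solve 3 (λ K η p → ((K :* η) :* (K :* η)) :* p := K :* ((K :* (η :* η)) :* p)) refl K η (P bad))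
          (≤-respʳ-≈ (sym (*-identityʳ K))
            (S.chebyshev (truncation-nonneg Adj) F≤1 (proj₁ (*-pos 0<K 0<η)) bad∈ deviates))))
        (≤-respʳ-≈ (sym (*-assoc _ _ _)) 1≤Kθ))

    correct : (𝐆 : Graphing) → let open Graphing 𝐆 in
       DegreesBoundedBy Adj D →
       (Ω : Set) (𝓕 : Family Ω) (P : Pred Ω 0ℓ → Carrier) → IsProbability 𝓕 P →
       (x : Fin k → Ω → J) → IndependentSample 𝓑 λ′ 𝓕 P x →
       let bad = λ ω → Σ[ S ∈ (Fin k → RootedGraph) ]
                         (∀ i → BallType Adj r (x i ω) (S i)) ×
                         ε ≤ ∣ estimate S - totalRank 𝐆 ∣
       in bad ∈ 𝓕 × P bad ≤ ε
    correct 𝐆 bounded Ω 𝓕 P P-prob x sample = bad∈ 𝐆 bounded P-prob sample , P-bad 𝐆 bounded P-prob sample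

theorem4p7 : (lem : ∀ {ℓ} → ExcludedMiddle ℓ) (ℝ : CompleteOrderedField) →
    let open CompleteOrderedField ℝ using (Tendsto)
        open Classical lem ℝ
    in LocallyEstimable totalRank
       × ((D : ℕ) (G : ℕ → FiniteGraph) (𝐆 : Graphing) →
          (∀ n → DegreesBoundedBy (FiniteGraph.Adj (G n)) D) →
          LocallyConverges G 𝐆 →
          Tendsto (λ n → finiteTotalRank (G n)) (totalRank 𝐆))
theorem4p7 lem ℝ = TotalRank.totalRank-estimable lem ℝ , λ _ G 𝐆 _ → TotalRank.totalRank-continuous lem ℝ G 𝐆
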